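{- Let $A = \sum\{t_i : i \in \omega\}$ and $B = \sum\{u_i : i \in \omega\}$ be special monomial sums, where there are natural numbers $m_i, n_i$ such that for each $i$, $t_i$ is $\omega^{m_i}$ or $(\omega^*)^{m_i}$ and $u_i$ is $\omega^{n_i}$ or $(\omega^*)^{n_i}$. Then $A \cong B$ if and only if $A \equiv B$.
   Context: $\omega^*$ is the reverse of $\omega$; $\omega^m$ and $(\omega^*)^m$ are the ordinal power and its reverse, with $\omega^0 = (\omega^*)^0 = 1$ the one-point order. $\sum\{t_i : i \in \omega\}$ denotes the concatenation $t_0 + t_1 + t_2 + \cdots$. A monomial sum (here over index set $\omega$) is such a sum in which, whenever $M$ and $N$ are consecutive terms, $M + N$ is isomorphic to neither $M$ nor $N$. It is special if no three consecutive terms are of the form $\omega, \omega^*, \omega^m$ or $(\omega^*)^m, \omega, \omega^*$ for any $m \ge 1$. $\equiv$ denotes elementary equivalence of linear orders (equivalently, player II wins the $n$-move Ehrenfeucht–Fraïssé game for every $n$). -}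

module Defs where

open import Level using (0ℓ)
open import Data.Nat using (ℕ; zero; suc; _<_; _≥_)
open import Data.Vec using (Vec; []; _∷_)
open import Data.Product using (Σ; _×_; _,_; ∃)
open import Data.Sum using (_⊎_; inj₁; inj₂)
open import Data.Empty using (⊥)
open import Data.List using (List; []; _∷_)
open import Data.List.Membership.Propositional using (_∈_)
open import Relation.Binary.PropositionalEquality using (_≡_)
open import Function.Bundles using (_⇔_)

record LO : Set₁ where
  field
    Carrier : Set
    _<ₒ_    : Carrier → Carrier → Set
open LO public

infix 4 _≅_ _≡ₑ_
infixl 6 _⊕_

record _≅_ (A B : LO) : Set where
  field
    to      : Carrier A → Carrier B
    from    : Carrier B → Carrier A
    from∘to : ∀ a → from (to a) ≡ a
    to∘from : ∀ b → to (from b) ≡ b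
    mono    : ∀ a a′ → (_<ₒ_ A a a′) ⇔ (_<ₒ_ B (to a) (to a′))

-- Lexicographic order on ℕ^m (most significant coordinate first):
-- its order type is the ordinal power ω^m (ω^0 = one point).
lex : ∀ {m} → Vec ℕ m → Vec ℕ m → Set
lex [] [] = ⊥
lex (x ∷ xs) (y ∷ ys) = x < y ⊎ (x ≡ y × lex xs ys)

ωPow : ℕ → LO
ωPow m = record { Carrier = Vec ℕ m ; _<ₒ_ = lex }

_* : LO → LO
A * = record { Carrier = Carrier A ; _<ₒ_ = λ x y → _<ₒ_ A y x }

ω*Pow : ℕ → LO
ω*Pow m = ωPow m *

data Dir : Set where
  fwd bwd : Dir

Code : Set
Code = Dir × ℕ

⟦_⟧ : Code → LO
⟦ fwd , m ⟧ = ωPow m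
⟦ bwd , m ⟧ = ω*Pow m

data PlusLt (M N : LO) : Carrier M ⊎ Carrier N → Carrier M ⊎ Carrier N → Set where
  l<l : ∀ {x y} → _<ₒ_ M x y → PlusLt M N (inj₁ x) (inj₁ y)
  l<r : ∀ {x y} → PlusLt M N (inj₁ x) (inj₂ y)
  r<r : ∀ {x y} → _<ₒ_ N x y → PlusLt M N (inj₂ x) (inj₂ y)

_⊕_ : LO → LO → LO
M ⊕ N = record { Carrier = Carrier M ⊎ Carrier N ; _<ₒ_ = PlusLt M N }

data SumLt (T : ℕ → LO) : Σ ℕ (λ i → Carrier (T i)) → Σ ℕ (λ i → Carrier (T i)) → Set where
  idx : ∀ {i j x y} → i < j → SumLt T (i , x) (j , y)
  inn : ∀ {i x y} → _<ₒ_ (T i) x y → SumLt T (i , x) (i , y)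

Σω : (ℕ → LO) → LO
Σω T = record { Carrier = Σ ℕ (λ i → Carrier (T i)) ; _<ₒ_ = SumLt T }

SumOf : (ℕ → Code) → LO
SumOf t = Σω (λ i → ⟦ t i ⟧)

Monomial : (ℕ → Code) → Set
Monomial t = ∀ i → ((⟦ t i ⟧ ⊕ ⟦ t (suc i) ⟧ ≅ ⟦ t i ⟧) → ⊥)
                 × ((⟦ t i ⟧ ⊕ ⟦ t (suc i) ⟧ ≅ ⟦ t (suc i) ⟧) → ⊥)

Special : (ℕ → Code) → Set
Special t = ∀ i →
  ((t i ≡ (fwd , 1) × t (suc i) ≡ (bwd , 1) × Σ ℕ (λ m → m ≥ 1 × t (suc (suc i)) ≡ (fwd , m))) → ⊥)
  × ((Σ ℕ (λ m → m ≥ 1 × t i ≡ (bwd , m)) × t (suc i) ≡ (fwd , 1) × t (suc (suc i)) ≡ (bwd , 1)) → ⊥)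

SpecialMonomial : (ℕ → Code) → Set
SpecialMonomial t = Monomial t × Special t

-- Ehrenfeucht–Fraïssé game. A position is the list of pairs chosen so far;
-- it is a partial isomorphism if it respects = and <.
PartialIso : (A B : LO) → List (Carrier A × Carrier B) → Set
PartialIso A B p = ∀ {a b a′ b′} → (a , b) ∈ p → (a′ , b′) ∈ p →
  ((a ≡ a′) ⇔ (b ≡ b′)) × ((_<ₒ_ A a a′) ⇔ (_<ₒ_ B b b′))

IIWins : (A B : LO) → ℕ → List (Carrier A × Carrier B) → Set
IIWins A B zero p = PartialIso A B p
IIWins A B (suc n) p =
    (∀ a → Σ (Carrier B) (λ b → IIWins A B n ((a , b) ∷ p)))
  × (∀ b → Σ (Carrier A) (λ a → IIWins A B n ((a , b) ∷ p)))

-- Elementary equivalence, via EF games: II wins the n-move game for every n.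
_≡ₑ_ : LO → LO → Set
A ≡ₑ B = ∀ n → IIWins A B n []

{-# OPTIONS --safe #-}

-- The terms of a special monomial sum are recovered one at a time from its theory, by
-- showing that equivalent sums have the same head and equivalent tails.  A formula that
-- defines the tail lets II play the tail game inside the game for the whole sum.
--
-- If the head is ω^a and the next term has a least element, the tail starts at the first
-- nonzero multiple of ω^a.  If the next term is (ω*)^b, the head is the largest initial
-- segment whose points are at pseudo-finite distance above a point without predecessor;
-- only ω + ω* hides this cut, but then the next cut, which the sum being special makes
-- visible, serves as well.  If the heads are ω^a and ω^b with a < b, then ω^a + ω^b = ω^b
-- lets one cancel terms on the left for ever, so the left sum is an ordinal at most ω^b;
-- the right one has more after ω^b, which a sentence detects.
--
-- Heads (ω*)^a are treated in the reversed orders.  Before ω^c the cut lies in the middle of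
-- a copy of ω* + ω and is not definable, but the end of that copy is, because the
-- sum is special; one cancels up to there and then puts ω back.

module Submission where

open import Defs
open import Data.Nat using (ℕ; zero; suc; _+_; _≤_; _<_; z≤n; s≤s; _⊔_)
open import Data.Nat.Properties
  using (≤-refl; ≤-trans; <-irrefl; <-trans; <-cmp; n<1+n; <-≤-trans; ≤-<-trans;
         m≤m⊔n; m≤n⊔m; m≤n⇒m≤1+n; m≤n+m; _≤?_; ≰⇒>; m≤n⇒m<n∨m≡n; <-asym)
open import Data.Fin using (Fin; zero; suc)
open import Data.Vec using (Vec; []; _∷_; lookup; replicate)
open import Data.Product using (Σ; _×_; _,_; proj₁; proj₂)
open import Data.Sum using (_⊎_; inj₁; inj₂)
open import Data.Empty using (⊥; ⊥-elim)
open import Data.Unit using (⊤; tt)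
open import Data.List using (List; []; _∷_; map)
open import Data.List.Membership.Propositional using (_∈_)
open import Data.List.Membership.Propositional.Properties using (∈-map⁺)
open import Data.List.Relation.Unary.Any using (here; there)
open import Relation.Binary.Definitions using (tri<; tri≈; tri>)
open import Relation.Binary.PropositionalEquality using (_≡_; refl; sym; trans; cong; subst; subst₂)
open import Relation.Nullary using (¬_; yes; no)
open import Function.Base using (_∘_; id)
open import Function.Bundles using (_⇔_; mk⇔; module Equivalence)
open Equivalence using () renaming (to to ⇒; from to ⇐)

infix 4 Lt Le
infixr 5 _⇒′_
infixr 6 _∧′_

Lt : (L : LO) → Carrier L → Carrier L → Set
Lt = _<ₒ_

syntax Lt L x y = x ≺[ L ] y

-- Negated strict order, so that it is literally the meaning of the formula `le`.
Le : (L : LO) → Carrier L → Carrier L → Set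
Le L x y = y ≺[ L ] x → ⊥

syntax Le L x y = x ≼[ L ] y

-- First-order formulas and the Ehrenfeucht–Fraïssé game

-- `at` evaluates a one-variable formula at any variable in scope, so that defined predicates nest
-- without renaming.
data Form : ℕ → Set where
  lt       : ∀ {n} → Fin n → Fin n → Form n
  fls      : ∀ {n} → Form n
  _∧′_ _⇒′_ : ∀ {n} → Form n → Form n → Form n
  ex all   : ∀ {n} → Form (suc n) → Form n
  at       : ∀ {n} → Form 1 → Fin n → Form n

eval : (L : LO) → ∀ {n} → Vec (Carrier L) n → Form n → Set
eval L ρ (lt i j) = lookup ρ i ≺[ L ] lookup ρ j
eval L ρ fls      = ⊥
eval L ρ (φ ∧′ ψ) = eval L ρ φ × eval L ρ ψ
eval L ρ (φ ⇒′ ψ) = eval L ρ φ → eval L ρ ψ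
eval L ρ (ex φ)   = Σ (Carrier L) λ x → eval L (x ∷ ρ) φ
eval L ρ (all φ)  = ∀ x → eval L (x ∷ ρ) φ
eval L ρ (at φ i) = eval L (lookup ρ i ∷ []) φ

rank : ∀ {n} → Form n → ℕ
rank (lt i j) = 0
rank fls      = 0
rank (φ ∧′ ψ) = rank φ ⊔ rank ψ
rank (φ ⇒′ ψ) = rank φ ⊔ rank ψ
rank (ex φ)   = suc (rank φ)
rank (all φ)  = suc (rank φ)
rank (at φ i) = rank φ

-- The surplus rounds are used up by letting I repeat `a`; the pair in the position guarantees that
-- such a move exists.
IIWins⇒PartialIso : ∀ {A B} n {p a b} → IIWins A B n p → (a , b) ∈ p → PartialIso A B p
IIWins⇒PartialIso zero    w m = w
IIWins⇒PartialIso (suc n) {a = a} w m =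
  λ x y → IIWins⇒PartialIso n (proj₂ (proj₁ w a)) (there m) (there x) (there y)

-- Induction on the formula: a quantifier costs one round, and its witness is II's answer. The
-- position may hold more pairs than the two assignments use.
IIWins⇒eval⇔ : ∀ {A B k} (φ : Form k) {n p} {ρ : Vec (Carrier A) k} {σ : Vec (Carrier B) k} →
  rank φ ≤ n → IIWins A B n p → (∀ i → (lookup ρ i , lookup σ i) ∈ p) →
  eval A ρ φ ⇔ eval B σ φ
IIWins⇒eval⇔ (lt i j) {n} r w m = proj₂ (IIWins⇒PartialIso n w (m i) (m i) (m j))
IIWins⇒eval⇔ fls r w m = mk⇔ id id
IIWins⇒eval⇔ (φ ∧′ ψ) r w m =
  mk⇔ (λ (x , y) → ⇒ f x , ⇒ g y) (λ (x , y) → ⇐ f x , ⇐ g y)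
  where
  f = IIWins⇒eval⇔ φ (≤-trans (m≤m⊔n _ _) r) w m
  g = IIWins⇒eval⇔ ψ (≤-trans (m≤n⊔m (rank φ) _) r) w m
IIWins⇒eval⇔ (φ ⇒′ ψ) r w m = mk⇔ (λ h → ⇒ g ∘ h ∘ ⇐ f) (λ h → ⇐ g ∘ h ∘ ⇒ f)
  where
  f = IIWins⇒eval⇔ φ (≤-trans (m≤m⊔n _ _) r) w m
  g = IIWins⇒eval⇔ ψ (≤-trans (m≤n⊔m (rank φ) _) r) w m
IIWins⇒eval⇔ (ex φ) (s≤s r) (w₁ , w₂) m = mk⇔
  (λ (a , h) → proj₁ (w₁ a) , ⇒ (IIWins⇒eval⇔ φ r (proj₂ (w₁ a)) λ { zero → here refl ; (suc i) → there (m i) }) h)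
  (λ (b , h) → proj₁ (w₂ b) , ⇐ (IIWins⇒eval⇔ φ r (proj₂ (w₂ b)) λ { zero → here refl ; (suc i) → there (m i) }) h)
IIWins⇒eval⇔ (all φ) (s≤s r) (w₁ , w₂) m = mk⇔
  (λ h b → ⇒ (IIWins⇒eval⇔ φ r (proj₂ (w₂ b)) λ { zero → here refl ; (suc i) → there (m i) }) (h (proj₁ (w₂ b))))
  (λ h a → ⇐ (IIWins⇒eval⇔ φ r (proj₂ (w₁ a)) λ { zero → here refl ; (suc i) → there (m i) }) (h (proj₁ (w₁ a))))
IIWins⇒eval⇔ (at φ i) r w m = IIWins⇒eval⇔ φ r w λ { zero → m i }

opaque
  ≡ₑ-sentence : ∀ {A B} (φ : Form 0) → A ≡ₑ B → eval A [] φ → eval B [] φ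
  ≡ₑ-sentence φ e = ⇒ (IIWins⇒eval⇔ φ ≤-refl (e (rank φ)) λ ())

IIWins-sym : ∀ {A B} n {p q} → (∀ {a b} → (b , a) ∈ q → (a , b) ∈ p) → IIWins A B n p → IIWins B A n q
IIWins-sym zero s w x y = let u , v = w (s x) (s y) in mk⇔ (⇐ u) (⇒ u) , mk⇔ (⇐ v) (⇒ v)
IIWins-sym {A} {B} (suc n) {p} {q} s (w₁ , w₂) =
  (λ b → proj₁ (w₂ b) , IIWins-sym n (ext s) (proj₂ (w₂ b))) ,
  (λ a → proj₁ (w₁ a) , IIWins-sym n (ext s) (proj₂ (w₁ a)))
  where
  ext : ∀ {c d p q} → (∀ {a b} → (b , a) ∈ q → (a , b) ∈ p) →
    ∀ {a : Carrier A} {b : Carrier B} → (b , a) ∈ ((d , c) ∷ q) → (a , b) ∈ ((c , d) ∷ p)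
  ext s (here refl) = here refl
  ext s (there m)   = there (s m)

≡ₑ-sym : ∀ {A B} → A ≡ₑ B → B ≡ₑ A
≡ₑ-sym e n = IIWins-sym n (λ ()) (e n)

IIWins-op : ∀ {A B} n {p} → IIWins A B n p → IIWins (A *) (B *) n p
IIWins-op zero w x y = proj₁ (w x y) , proj₂ (w y x)
IIWins-op (suc n) (w₁ , w₂) =
  (λ a → proj₁ (w₁ a) , IIWins-op n (proj₂ (w₁ a))) ,
  (λ b → proj₁ (w₂ b) , IIWins-op n (proj₂ (w₂ b)))

≡ₑ-op : ∀ {A B} → A ≡ₑ B → A * ≡ₑ B *
≡ₑ-op e n = IIWins-op n (e n)

record Defines (A X : LO) (φ : Form 1) (f : Carrier X → Carrier A) : Set where
  field
    inj    : ∀ {x y} → f x ≡ f y → x ≡ y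
    pres   : ∀ {x y} → x ≺[ X ] y ⇔ f x ≺[ A ] f y
    sound  : ∀ x → eval A (f x ∷ []) φ
    onto   : ∀ a → eval A (a ∷ []) φ → Σ (Carrier X) λ x → f x ≡ a

module _ {A B X Y : LO} (φ : Form 1) {f : Carrier X → Carrier A} {g : Carrier Y → Carrier B}
         (F : Defines A X φ f) (G : Defines B Y φ g) where
  private
    module F = Defines F
    module G = Defines G

    h : Carrier X × Carrier Y → Carrier A × Carrier B
    h (x , y) = f x , g y

    -- The rank of φ is kept in reserve, so that II's answers stay inside the part defined by φ.
    restrict : ∀ n p → IIWins A B (n + rank φ) (map h p) → IIWins X Y n p
    restrict zero p w {x} {y} {x′} {y′} m m′ =
      let u , v = IIWins⇒PartialIso (rank φ) w (∈-map⁺ h m) (∈-map⁺ h m) (∈-map⁺ h m′)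
      in mk⇔ (λ e → G.inj (⇒ u (cong f e))) (λ e → F.inj (⇐ u (cong g e))) ,
         mk⇔ (λ l → ⇐ G.pres (⇒ v (⇒ F.pres l))) (λ l → ⇐ F.pres (⇐ v (⇒ G.pres l)))
    restrict (suc n) p (w₁ , w₂) = forth , back
      where
      forth : ∀ x → Σ (Carrier Y) λ y → IIWins X Y n ((x , y) ∷ p)
      forth x with w₁ (f x)
      ... | b , w with G.onto b (⇒ (IIWins⇒eval⇔ φ (m≤n+m _ n) w λ { zero → here refl }) (F.sound x))
      ... | y , refl = y , restrict n ((x , y) ∷ p) w
      back : ∀ y → Σ (Carrier X) λ x → IIWins X Y n ((x , y) ∷ p)
      back y with w₂ (g y)
      ... | a , w with F.onto a (⇐ (IIWins⇒eval⇔ φ (m≤n+m _ n) w λ { zero → here refl }) (G.sound y))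
      ... | x , refl = x , restrict n ((x , y) ∷ p) w

  -- The game on the definable parts is played inside a game on the whole orders that is `rank φ`
  -- rounds longer.
  ≡ₑ-restrict : A ≡ₑ B → X ≡ₑ Y
  ≡ₑ-restrict e n = restrict n [] (e (n + rank φ))

-- Invariance of the game under isomorphism

true′ : Form 1
true′ = fls ⇒′ fls

-- This is the case where the defined part is everything; it makes invariance of `≡ₑ` under `≅` an
-- instance of `≡ₑ-restrict`.
≅⇒Defines : ∀ {A B} (i : A ≅ B) → Defines B A true′ (_≅_.to i)
≅⇒Defines i = record
  { inj   = λ {x} {y} e → trans (sym (from∘to x)) (trans (cong from e) (from∘to y))
  ; pres  = λ {x} {y} → mono x y
  ; sound = λ _ → id
  ; onto  = λ b _ → from b , to∘from b }
  where open _≅_ i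

≅-refl : ∀ {A} → A ≅ A
≅-refl = record { to = id ; from = id ; from∘to = λ _ → refl ; to∘from = λ _ → refl ; mono = λ _ _ → mk⇔ id id }

≅-sym : ∀ {A B} → A ≅ B → B ≅ A
≅-sym {A} {B} i = record
  { to = from ; from = to ; from∘to = to∘from ; to∘from = from∘to
  ; mono = λ b b′ → mk⇔
      (λ l → ⇐ (mono _ _) (subst₂ (Lt B) (sym (to∘from b)) (sym (to∘from b′)) l))
      (λ l → subst₂ (Lt B) (to∘from b) (to∘from b′) (⇒ (mono _ _) l)) }
  where open _≅_ i

≅-trans : ∀ {A B C} → A ≅ B → B ≅ C → A ≅ C
≅-trans i j = record
  { to = J.to ∘ I.to ; from = I.from ∘ J.from
  ; from∘to = λ a → trans (cong I.from (J.from∘to _)) (I.from∘to a)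
  ; to∘from = λ c → trans (cong J.to (I.to∘from _)) (J.to∘from c)
  ; mono = λ a a′ → mk⇔ (⇒ (J.mono _ _) ∘ ⇒ (I.mono a a′)) (⇐ (I.mono a a′) ∘ ⇐ (J.mono _ _)) }
  where module I = _≅_ i
        module J = _≅_ j

≡ₑ-resp-≅ : ∀ {A A′ B B′} → A ≅ A′ → B ≅ B′ → A ≡ₑ B → A′ ≡ₑ B′
≡ₑ-resp-≅ i j = ≡ₑ-restrict true′ (≅⇒Defines (≅-sym i)) (≅⇒Defines (≅-sym j))

≡ₑ-refl : ∀ {A} → A ≡ₑ A
≡ₑ-refl {A} n = copy n [] λ ()
  where
  copy : ∀ n p → (∀ {a b} → (a , b) ∈ p → a ≡ b) → IIWins A A n p
  copy zero p d m m′ with refl ← d m | refl ← d m′ = mk⇔ id id , mk⇔ id id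
  copy (suc n) p d = (λ a → a , copy n _ ext) , (λ a → a , copy n _ ext)
    where
    ext : ∀ {c a b} → (a , b) ∈ ((c , c) ∷ p) → a ≡ b
    ext (here refl) = refl
    ext (there m)   = d m

≅⇒≡ₑ : ∀ {A B} → A ≅ B → A ≡ₑ B
≅⇒≡ₑ i = ≡ₑ-resp-≅ ≅-refl i ≡ₑ-refl

≅-sentence : ∀ {A B} (φ : Form 0) → A ≅ B → eval B [] φ → eval A [] φ
≅-sentence φ i = ≡ₑ-sentence φ (≅⇒≡ₑ (≅-sym i))

-- Adding a common summand on the left

module _ (N : LO) {X Y : LO} (x₀ : Carrier X) where
  private
    -- The position `p` on the right may contain dummy pairs that do not occur in `q`.
    Extends : List (Carrier X × Carrier Y) → List (Carrier (N ⊕ X) × Carrier (N ⊕ Y)) → Set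
    Extends p q = ∀ {a b} → (a , b) ∈ q →
      Σ (Carrier N) (λ c → a ≡ inj₁ c × b ≡ inj₁ c) ⊎
      Σ (Carrier X) (λ x → Σ (Carrier Y) λ y → a ≡ inj₂ x × b ≡ inj₂ y × (x , y) ∈ p)

    add : ∀ n p q → Extends p q → IIWins X Y n p → IIWins (N ⊕ X) (N ⊕ Y) n q
    add zero p q E w m m′ with E m | E m′
    ... | inj₁ (c , refl , refl) | inj₁ (d , refl , refl) =
      mk⇔ (λ { refl → refl }) (λ { refl → refl }) , mk⇔ (λ { (l<l l) → l<l l }) (λ { (l<l l) → l<l l })
    ... | inj₁ (c , refl , refl) | inj₂ (x , y , refl , refl , _) =
      mk⇔ (λ ()) (λ ()) , mk⇔ (λ _ → l<r) (λ _ → l<r)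
    ... | inj₂ (x , y , refl , refl , _) | inj₁ (c , refl , refl) =
      mk⇔ (λ ()) (λ ()) , mk⇔ (λ ()) (λ ())
    ... | inj₂ (x , y , refl , refl , k) | inj₂ (x′ , y′ , refl , refl , k′) =
      let u , v = w k k′ in
      mk⇔ (λ { refl → cong inj₂ (⇒ u refl) }) (λ { refl → cong inj₂ (⇐ u refl) }) ,
      mk⇔ (λ { (r<r l) → r<r (⇒ v l) }) (λ { (r<r l) → r<r (⇐ v l) })
    add (suc n) p q E (w₁ , w₂) = forth , back
      where
      right : ∀ {x y} → Extends ((x , y) ∷ p) ((inj₂ x , inj₂ y) ∷ q)
      right (here refl) = inj₂ (_ , _ , refl , refl , here refl)
      right (there m) with E m
      ... | inj₁ z = inj₁ z
      ... | inj₂ (x , y , e , e′ , k) = inj₂ (x , y , e , e′ , there k)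
      weaken : ∀ {xy c} → Extends (xy ∷ p) ((inj₁ c , inj₁ c) ∷ q)
      weaken (here refl) = inj₁ (_ , refl , refl)
      weaken (there m) with E m
      ... | inj₁ z = inj₁ z
      ... | inj₂ (x , y , e , e′ , k) = inj₂ (x , y , e , e′ , there k)
      forth : ∀ a → Σ (Carrier (N ⊕ Y)) λ b → IIWins (N ⊕ X) (N ⊕ Y) n ((a , b) ∷ q)
      -- A move in `N` is copied; the game on the right loses a round as well, spent on the dummy
      -- move `x₀`.
      forth (inj₁ c) = inj₁ c , add n _ _ weaken (proj₂ (w₁ x₀))
      forth (inj₂ x) = inj₂ (proj₁ (w₁ x)) , add n _ _ right (proj₂ (w₁ x))
      back : ∀ b → Σ (Carrier (N ⊕ X)) λ a → IIWins (N ⊕ X) (N ⊕ Y) n ((a , b) ∷ q)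
      back (inj₁ c) = inj₁ c , add n _ _ weaken (proj₂ (w₁ x₀))
      back (inj₂ y) = inj₂ (proj₁ (w₂ y)) , add n _ _ right (proj₂ (w₂ y))

  ⊕-congʳ-≡ₑ : X ≡ₑ Y → N ⊕ X ≡ₑ N ⊕ Y
  ⊕-congʳ-≡ₑ e n = add n [] [] (λ ()) (e n)

-- Linear orders and isomorphisms between sums

record Lin (L : LO) : Set where
  field
    irr : ∀ {x} → x ≺[ L ] x → ⊥
    tr  : ∀ {x y z} → x ≺[ L ] y → y ≺[ L ] z → x ≺[ L ] z
    cmp : ∀ x y → x ≺[ L ] y ⊎ x ≡ y ⊎ y ≺[ L ] x

  ≼≺-tr : ∀ {x y z} → x ≼[ L ] y → y ≺[ L ] z → x ≺[ L ] z
  ≼≺-tr {x} {y} a b with cmp x y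
  ... | inj₁ l           = tr l b
  ... | inj₂ (inj₁ refl) = b
  ... | inj₂ (inj₂ l)    = ⊥-elim (a l)

  ≺≼-tr : ∀ {x y z} → x ≺[ L ] y → y ≼[ L ] z → x ≺[ L ] z
  ≺≼-tr {x} {y} {z} a b with cmp y z
  ... | inj₁ l           = tr a l
  ... | inj₂ (inj₁ refl) = a
  ... | inj₂ (inj₂ l)    = ⊥-elim (b l)

  ≼-tr : ∀ {x y z} → x ≼[ L ] y → y ≼[ L ] z → x ≼[ L ] z
  ≼-tr a b l = irr (≺≼-tr (≺≼-tr l a) b)

  ≺⇒≼ : ∀ {x y} → x ≺[ L ] y → x ≼[ L ] y
  ≺⇒≼ a b = irr (tr a b)

  ≼-split : ∀ x y → x ≼[ L ] y ⊎ y ≺[ L ] x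
  ≼-split x y with cmp x y
  ... | inj₁ l           = inj₁ (≺⇒≼ l)
  ... | inj₂ (inj₁ refl) = inj₁ irr
  ... | inj₂ (inj₂ l)    = inj₂ l

  ≼⇒≺⊎≡ : ∀ {x y} → x ≼[ L ] y → x ≺[ L ] y ⊎ x ≡ y
  ≼⇒≺⊎≡ {x} {y} a with cmp x y
  ... | inj₁ l           = inj₁ l
  ... | inj₂ (inj₁ e)    = inj₂ e
  ... | inj₂ (inj₂ l)    = ⊥-elim (a l)

op-lin : ∀ {L} → Lin L → Lin (L *)
op-lin {L} lin = record { irr = irr ; tr = λ a b → tr b a ; cmp = λ x y → flip (cmp y x) }
  where
  open Lin lin
  flip : ∀ {x y} → y ≺[ L ] x ⊎ y ≡ x ⊎ x ≺[ L ] y → y ≺[ L ] x ⊎ x ≡ y ⊎ x ≺[ L ] y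
  flip (inj₁ l)        = inj₁ l
  flip (inj₂ (inj₁ e)) = inj₂ (inj₁ (sym e))
  flip (inj₂ (inj₂ l)) = inj₂ (inj₂ l)

-- Linearity of powers and sums

lex-irr : ∀ {m} (v : Vec ℕ m) → lex v v → ⊥
lex-irr (x ∷ v) (inj₁ l)       = <-irrefl refl l
lex-irr (x ∷ v) (inj₂ (_ , l)) = lex-irr v l

lex-tr : ∀ {m} (u v w : Vec ℕ m) → lex u v → lex v w → lex u w
lex-tr [] [] [] ()
lex-tr (x ∷ u) (y ∷ v) (z ∷ w) (inj₁ a) (inj₁ b) = inj₁ (<-trans a b)
lex-tr (x ∷ u) (y ∷ v) (z ∷ w) (inj₁ a) (inj₂ (refl , b)) = inj₁ a
lex-tr (x ∷ u) (y ∷ v) (z ∷ w) (inj₂ (refl , a)) (inj₁ b) = inj₁ b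
lex-tr (x ∷ u) (y ∷ v) (z ∷ w) (inj₂ (refl , a)) (inj₂ (refl , b)) = inj₂ (refl , lex-tr u v w a b)

lex-cmp : ∀ {m} (u v : Vec ℕ m) → lex u v ⊎ u ≡ v ⊎ lex v u
lex-cmp [] [] = inj₂ (inj₁ refl)
lex-cmp (x ∷ u) (y ∷ v) with <-cmp x y
... | tri< l _ _ = inj₁ (inj₁ l)
... | tri> _ _ l = inj₂ (inj₂ (inj₁ l))
... | tri≈ _ refl _ with lex-cmp u v
... | inj₁ l           = inj₁ (inj₂ (refl , l))
... | inj₂ (inj₁ refl) = inj₂ (inj₁ refl)
... | inj₂ (inj₂ l)    = inj₂ (inj₂ (inj₂ (refl , l)))

ωPow-lin : ∀ m → Lin (ωPow m)
ωPow-lin m = record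
  { irr = λ {x} → lex-irr x ; tr = λ {x} {y} {z} → lex-tr x y z ; cmp = lex-cmp }

⊕-lin : ∀ {M N} → Lin M → Lin N → Lin (M ⊕ N)
⊕-lin {M} {N} lM lN = record { irr = irr ; tr = tr ; cmp = cmp }
  where
  module M = Lin lM
  module N = Lin lN
  irr : ∀ {x} → PlusLt M N x x → ⊥
  irr (l<l l) = M.irr l
  irr (r<r l) = N.irr l
  tr : ∀ {x y z} → PlusLt M N x y → PlusLt M N y z → PlusLt M N x z
  tr (l<l a) (l<l b) = l<l (M.tr a b)
  tr (l<l a) l<r     = l<r
  tr l<r     (r<r b) = l<r
  tr (r<r a) (r<r b) = r<r (N.tr a b)
  cmp : ∀ x y → PlusLt M N x y ⊎ x ≡ y ⊎ PlusLt M N y x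
  cmp (inj₁ x) (inj₂ y) = inj₁ l<r
  cmp (inj₂ x) (inj₁ y) = inj₂ (inj₂ l<r)
  cmp (inj₁ x) (inj₁ y) with M.cmp x y
  ... | inj₁ l           = inj₁ (l<l l)
  ... | inj₂ (inj₁ refl) = inj₂ (inj₁ refl)
  ... | inj₂ (inj₂ l)    = inj₂ (inj₂ (l<l l))
  cmp (inj₂ x) (inj₂ y) with N.cmp x y
  ... | inj₁ l           = inj₁ (r<r l)
  ... | inj₂ (inj₁ refl) = inj₂ (inj₁ refl)
  ... | inj₂ (inj₂ l)    = inj₂ (inj₂ (r<r l))

Σω-lin : ∀ {T} → (∀ i → Lin (T i)) → Lin (Σω T)
Σω-lin {T} lT = record { irr = irr ; tr = tr ; cmp = cmp }
  where
  irr : ∀ {x} → SumLt T x x → ⊥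
  irr (idx l)     = <-irrefl refl l
  irr (inn {i} l) = Lin.irr (lT i) l
  tr : ∀ {x y z} → SumLt T x y → SumLt T y z → SumLt T x z
  tr (idx a) (idx b)     = idx (<-trans a b)
  tr (idx a) (inn b)     = idx a
  tr (inn a) (idx b)     = idx b
  tr (inn {i} a) (inn b) = inn (Lin.tr (lT i) a b)
  cmp : ∀ x y → SumLt T x y ⊎ x ≡ y ⊎ SumLt T y x
  cmp (i , x) (j , y) with <-cmp i j
  ... | tri< l _ _ = inj₁ (idx l)
  ... | tri> _ _ l = inj₂ (inj₂ (idx l))
  ... | tri≈ _ refl _ with Lin.cmp (lT i) x y
  ... | inj₁ l           = inj₁ (inn l)
  ... | inj₂ (inj₁ refl) = inj₂ (inj₁ refl)
  ... | inj₂ (inj₂ l)    = inj₂ (inj₂ (inn l))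

-- Isomorphisms between sums

≅-op : ∀ {A B} → A ≅ B → A * ≅ B *
≅-op i = record
  { to = to ; from = from ; from∘to = from∘to ; to∘from = to∘from ; mono = λ a a′ → mono a′ a }
  where open _≅_ i

⊕-cong : ∀ {A A′ B B′} → A ≅ A′ → B ≅ B′ → A ⊕ B ≅ A′ ⊕ B′
⊕-cong {A} {A′} {B} {B′} i j = record
  { to = λ { (inj₁ x) → inj₁ (I.to x) ; (inj₂ y) → inj₂ (J.to y) }
  ; from = λ { (inj₁ x) → inj₁ (I.from x) ; (inj₂ y) → inj₂ (J.from y) }
  ; from∘to = λ { (inj₁ x) → cong inj₁ (I.from∘to x) ; (inj₂ y) → cong inj₂ (J.from∘to y) }
  ; to∘from = λ { (inj₁ x) → cong inj₁ (I.to∘from x) ; (inj₂ y) → cong inj₂ (J.to∘from y) }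
  ; mono = λ
    { (inj₁ x) (inj₁ y) → mk⇔ (λ { (l<l l) → l<l (⇒ (I.mono x y) l) }) (λ { (l<l l) → l<l (⇐ (I.mono x y) l) })
    ; (inj₁ x) (inj₂ y) → mk⇔ (λ _ → l<r) (λ _ → l<r)
    ; (inj₂ x) (inj₁ y) → mk⇔ (λ ()) (λ ())
    ; (inj₂ x) (inj₂ y) → mk⇔ (λ { (r<r l) → r<r (⇒ (J.mono x y) l) }) (λ { (r<r l) → r<r (⇐ (J.mono x y) l) }) } }
  where module I = _≅_ i
        module J = _≅_ j

⊕-assoc : ∀ A B C → (A ⊕ B) ⊕ C ≅ A ⊕ (B ⊕ C)
⊕-assoc A B C = record
  { to = λ { (inj₁ (inj₁ x)) → inj₁ x ; (inj₁ (inj₂ x)) → inj₂ (inj₁ x) ; (inj₂ x) → inj₂ (inj₂ x) }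
  ; from = λ { (inj₁ x) → inj₁ (inj₁ x) ; (inj₂ (inj₁ x)) → inj₁ (inj₂ x) ; (inj₂ (inj₂ x)) → inj₂ x }
  ; from∘to = λ { (inj₁ (inj₁ x)) → refl ; (inj₁ (inj₂ x)) → refl ; (inj₂ x) → refl }
  ; to∘from = λ { (inj₁ x) → refl ; (inj₂ (inj₁ x)) → refl ; (inj₂ (inj₂ x)) → refl }
  ; mono = λ
    { (inj₁ (inj₁ x)) (inj₁ (inj₁ y)) → mk⇔ (λ { (l<l (l<l l)) → l<l l }) (λ { (l<l l) → l<l (l<l l) })
    ; (inj₁ (inj₁ x)) (inj₁ (inj₂ y)) → mk⇔ (λ _ → l<r) (λ _ → l<l l<r)
    ; (inj₁ (inj₁ x)) (inj₂ y) → mk⇔ (λ _ → l<r) (λ _ → l<r)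
    ; (inj₁ (inj₂ x)) (inj₁ (inj₁ y)) → mk⇔ (λ { (l<l ()) }) (λ ())
    ; (inj₁ (inj₂ x)) (inj₁ (inj₂ y)) → mk⇔ (λ { (l<l (r<r l)) → r<r (l<l l) }) (λ { (r<r (l<l l)) → l<l (r<r l) })
    ; (inj₁ (inj₂ x)) (inj₂ y) → mk⇔ (λ _ → r<r l<r) (λ _ → l<r)
    ; (inj₂ x) (inj₁ (inj₁ y)) → mk⇔ (λ ()) (λ ())
    ; (inj₂ x) (inj₁ (inj₂ y)) → mk⇔ (λ ()) (λ { (r<r ()) })
    ; (inj₂ x) (inj₂ y) → mk⇔ (λ { (r<r l) → r<r (r<r l) }) (λ { (r<r (r<r l)) → r<r l }) } }

op-⊕ : ∀ A B → (A ⊕ B) * ≅ B * ⊕ A *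
op-⊕ A B = record
  { to = λ { (inj₁ x) → inj₂ x ; (inj₂ x) → inj₁ x }
  ; from = λ { (inj₁ x) → inj₂ x ; (inj₂ x) → inj₁ x }
  ; from∘to = λ { (inj₁ x) → refl ; (inj₂ x) → refl }
  ; to∘from = λ { (inj₁ x) → refl ; (inj₂ x) → refl }
  ; mono = λ
    { (inj₁ x) (inj₁ y) → mk⇔ (λ { (l<l l) → r<r l }) (λ { (r<r l) → l<l l })
    ; (inj₁ x) (inj₂ y) → mk⇔ (λ ()) (λ ())
    ; (inj₂ x) (inj₁ y) → mk⇔ (λ _ → l<r) (λ _ → l<r)
    ; (inj₂ x) (inj₂ y) → mk⇔ (λ { (r<r l) → l<l l }) (λ { (l<l l) → r<r l }) } }

Σω-cong : ∀ {T U} → (∀ i → T i ≅ U i) → Σω T ≅ Σω U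
Σω-cong {T} {U} i = record
  { to = λ (j , x) → j , to (i j) x
  ; from = λ (j , x) → j , from (i j) x
  ; from∘to = λ (j , x) → cong (j ,_) (from∘to (i j) x)
  ; to∘from = λ (j , x) → cong (j ,_) (to∘from (i j) x)
  ; mono = λ a b → mk⇔ (λ { (idx l) → idx l ; (inn {j} l) → inn (⇒ (mono (i j) _ _) l) })
      (back a b) }
  where
  open _≅_
  back : ∀ a b → SumLt U (proj₁ a , to (i (proj₁ a)) (proj₂ a)) (proj₁ b , to (i (proj₁ b)) (proj₂ b)) → SumLt T a b
  back a b (idx l)     = idx l
  back a b (inn {j} l) = inn (⇐ (mono (i j) _ _) l)

Σω-split : ∀ T → Σω T ≅ T 0 ⊕ Σω (T ∘ suc)
Σω-split T = record
  { to = to ; from = from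
  ; from∘to = λ { (zero , x) → refl ; (suc i , x) → refl }
  ; to∘from = λ { (inj₁ x) → refl ; (inj₂ (i , x)) → refl }
  ; mono = λ
    { (zero , x) (zero , y) → mk⇔ (λ { (inn l) → l<l l }) (λ { (l<l l) → inn l })
    ; (zero , x) (suc j , y) → mk⇔ (λ _ → l<r) (λ _ → idx (s≤s z≤n))
    ; (suc i , x) (zero , y) → mk⇔ (λ { (idx ()) }) (λ ())
    ; (suc i , x) (suc j , y) → mk⇔ (λ { (idx (s≤s l)) → r<r (idx l) ; (inn l) → r<r (inn l) })
                                    (λ { (r<r (idx l)) → idx (s≤s l) ; (r<r (inn l)) → inn l }) } }
  where
  to : Carrier (Σω T) → Carrier (T 0 ⊕ Σω (T ∘ suc))
  to (zero , x)  = inj₁ x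
  to (suc i , x) = inj₂ (i , x)
  from : Carrier (T 0 ⊕ Σω (T ∘ suc)) → Carrier (Σω T)
  from (inj₁ x)       = zero , x
  from (inj₂ (i , x)) = suc i , x

-- Absorption of smaller powers

ωPow-absorb₁ : ∀ a → ωPow a ⊕ ωPow (suc a) ≅ ωPow (suc a)
ωPow-absorb₁ a = record
  -- The added copy of ω^a becomes the block with leading coordinate 0, and every other block moves
  -- up by one.
  { to = λ { (inj₁ v) → 0 ∷ v ; (inj₂ (n ∷ v)) → suc n ∷ v }
  ; from = λ { (zero ∷ v) → inj₁ v ; (suc n ∷ v) → inj₂ (n ∷ v) }
  ; from∘to = λ { (inj₁ v) → refl ; (inj₂ (n ∷ v)) → refl }
  ; to∘from = λ { (zero ∷ v) → refl ; (suc n ∷ v) → refl }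
  ; mono = λ
    { (inj₁ u) (inj₁ v) → mk⇔ (λ { (l<l l) → inj₂ (refl , l) }) (λ { (inj₂ (_ , l)) → l<l l })
    ; (inj₁ u) (inj₂ (n ∷ v)) → mk⇔ (λ _ → inj₁ (s≤s z≤n)) (λ _ → l<r)
    ; (inj₂ (n ∷ v)) (inj₁ u) → mk⇔ (λ ()) (λ { (inj₁ ()) ; (inj₂ (() , _)) })
    ; (inj₂ (m ∷ u)) (inj₂ (n ∷ v)) →
        mk⇔ (λ { (r<r (inj₁ l)) → inj₁ (s≤s l) ; (r<r (inj₂ (refl , l))) → inj₂ (refl , l) })
            (λ { (inj₁ (s≤s l)) → r<r (inj₁ l) ; (inj₂ (refl , l)) → r<r (inj₂ (refl , l)) }) } }

-- By induction, ω^a + ω^(b+1) = (ω^a + ω^b) + ω^(b+1) = ω^b + ω^(b+1) = ω^(b+1).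
ωPow-absorb : ∀ {a b} → a < b → ωPow a ⊕ ωPow b ≅ ωPow b
ωPow-absorb {a} {suc b} (s≤s a≤b) with m≤n⇒m<n∨m≡n a≤b
... | inj₂ refl = ωPow-absorb₁ a
... | inj₁ a<b  =
  ≅-trans (⊕-cong ≅-refl (≅-sym (ωPow-absorb₁ b)))
    (≅-trans (≅-sym (⊕-assoc _ _ _))
      (≅-trans (⊕-cong (ωPow-absorb a<b) ≅-refl) (ωPow-absorb₁ b)))

ω*Pow-absorb : ∀ {a b} → a < b → ω*Pow b ⊕ ω*Pow a ≅ ω*Pow b
ω*Pow-absorb {a} {b} a<b = ≅-trans (≅-sym (op-⊕ (ωPow a) (ωPow b))) (≅-op (ωPow-absorb a<b))

-- Definable predicates

pattern v0 = zero
pattern v1 = suc zero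
pattern v2 = suc (suc zero)

le : ∀ {n} → Fin n → Fin n → Form n
le i j = lt j i ⇒′ fls

neg : ∀ {n} → Form n → Form n
neg φ = φ ⇒′ fls

hasPred hasSucc : Form 1
hasPred = ex (lt v0 v1 ∧′ all (lt v1 v0 ⇒′ lt v0 v2 ⇒′ fls))
hasSucc = ex (lt v1 v0 ∧′ all (lt v0 v1 ⇒′ lt v2 v0 ⇒′ fls))

near : ∀ {n} → Fin n → Fin n → Form n
near i j = le i j ∧′
  (all (lt (suc i) v0 ⇒′ le v0 (suc j) ⇒′ at hasPred v0) ∧′
   all (le (suc i) v0 ⇒′ lt v0 (suc j) ⇒′ at hasSucc v0))

-- In an ordinal every point is λ + n with λ zero or a limit, hence based; a failure of this
-- property therefore shows where an initial ordinal has ended.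
based : Form 1
based = ex (neg (at hasPred v0) ∧′ near v0 v1)

isLim : ℕ → Form 1
isLim zero    = ex (lt v0 v1)
isLim (suc k) = ex (lt v0 v1) ∧′
  all (lt v0 v1 ⇒′ ex (lt v1 v0 ∧′ lt v0 v2 ∧′ at (isLim k) v0))

HasPred HasSucc Based : (L : LO) → Carrier L → Set
HasPred L x = eval L (x ∷ []) hasPred
HasSucc L x = eval L (x ∷ []) hasSucc
Based L x   = eval L (x ∷ []) based

-- The first-order shadow of [x, y] being finite; it also holds for the ends of ω + ω*.
Near : (L : LO) → Carrier L → Carrier L → Set
Near L x y = eval L (x ∷ y ∷ []) (near v0 v1)

-- In an ordinal these are the nonzero multiples of ω^k.
Lim : (L : LO) → ℕ → Carrier L → Set
Lim L k x = eval L (x ∷ []) (isLim k)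

near-op : ∀ {L x y} → Near L x y → Near (L *) y x
near-op (l , p , s) = l , (λ w a b → s w b a) , (λ w a b → p w b a)

Cov : (L : LO) → Carrier L → Carrier L → Set
Cov L x y = x ≺[ L ] y × (∀ w → x ≺[ L ] w → w ≺[ L ] y → ⊥)

cov-op : ∀ {L x y} → Cov L x y → Cov (L *) y x
cov-op (l , g) = l , λ w a b → g w b a

cov⇒hasPred : ∀ {L x y} → Cov L x y → HasPred L y
cov⇒hasPred {x = x} c = x , c

cov⇒hasSucc : ∀ {L x y} → Cov L x y → HasSucc L x
cov⇒hasSucc {L} {y = y} c = y , cov-op {L} c

module _ {L} (lin : Lin L) where
  open Lin lin

  near-refl : ∀ x → Near L x x
  near-refl x = irr , (λ w a b → ⊥-elim (b a)) , (λ w a b → ⊥-elim (a b))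

  near-trans : ∀ {x y z} → Near L x y → Near L y z → Near L x z
  near-trans {x} {y} {z} (l , p , s) (l′ , p′ , s′) = ≼-tr l l′ , pred , succ
    where
    pred : ∀ w → x ≺[ L ] w → w ≼[ L ] z → HasPred L w
    pred w a b with ≼-split w y
    ... | inj₁ c = p w a c
    ... | inj₂ c = p′ w c b
    succ : ∀ w → x ≼[ L ] w → w ≺[ L ] z → HasSucc L w
    succ w a b with ≼-split y w
    ... | inj₁ c = s′ w c b
    ... | inj₂ c = s w a c

  cov⇒near : ∀ {x y} → Cov L x y → Near L x y
  cov⇒near {x} {y} c@(l , g) = ≺⇒≼ l , pred , succ
    where
    pred : ∀ w → x ≺[ L ] w → w ≼[ L ] y → HasPred L w
    pred w a b with ≼⇒≺⊎≡ b
    ... | inj₁ d    = ⊥-elim (g w a d)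
    ... | inj₂ refl = cov⇒hasPred {L} c
    succ : ∀ w → x ≼[ L ] w → w ≺[ L ] y → HasSucc L w
    succ w a b with ≼⇒≺⊎≡ a
    ... | inj₁ d    = ⊥-elim (g w d b)
    ... | inj₂ refl = cov⇒hasSucc {L} c

  near-sub : ∀ {x x′ y′ y} → x ≼[ L ] x′ → x′ ≼[ L ] y′ → y′ ≼[ L ] y → Near L x y → Near L x′ y′
  near-sub a b c (l , p , s) =
    b , (λ w i j → p w (≼≺-tr a i) (≼-tr j c)) , (λ w i j → s w (≼-tr a i) (≺≼-tr j c))

  based-near : ∀ {x y} → Based L x → Near L x y → Based L y
  based-near (z , p , n) m = z , p , near-trans n m

  ¬hasPred⇒based : ∀ {x} → ¬ HasPred L x → Based L x
  ¬hasPred⇒based {x} p = x , p , near-refl x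

  lim-pred : ∀ k {x} → Lim L (suc k) x → Lim L k x
  lim-pred zero    (m , h) = m
  lim-pred (suc k) (m , h) = m , λ z l → let w , a , b , c = h z l in w , a , b , lim-pred k c

  lim-≤ : ∀ {j k x} → j ≤ k → Lim L k x → Lim L j x
  lim-≤ {j} {k} j≤k h with m≤n⇒m<n∨m≡n j≤k
  ... | inj₂ refl      = h
  ... | inj₁ (s≤s {n = k′} j≤k′) = lim-≤ j≤k′ (lim-pred k′ h)

  lim⇒¬hasPred : ∀ k {x} → Lim L (suc k) x → ¬ HasPred L x
  lim⇒¬hasPred k (m , h) (z , l , g) = let w , a , b , _ = h z l in g w a b

-- Convex embeddings of powers of ω

-- Convexity of the image keeps immediate neighbours immediate, so `HasPred` and `HasSucc` carry
-- over to the larger order.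
record Conv (M L : LO) (e : Carrier M → Carrier L) : Set where
  field
    pres : ∀ {x y} → x ≺[ M ] y → e x ≺[ L ] e y
    refl⁻ : ∀ {x y} → e x ≺[ L ] e y → x ≺[ M ] y
    conv : ∀ {x y} w → e x ≺[ L ] w → w ≺[ L ] e y → Σ (Carrier M) λ z → e z ≡ w

  pres-cov : ∀ {x y} → Cov M x y → Cov L (e x) (e y)
  pres-cov {x} {y} (l , g) = pres l , gap
    where
    gap : ∀ w → e x ≺[ L ] w → w ≺[ L ] e y → ⊥
    gap w a b with conv w a b
    ... | z , refl = g z (refl⁻ a) (refl⁻ b)

  pres-hasPred : ∀ {x} → HasPred M x → HasPred L (e x)
  pres-hasPred (z , c) = cov⇒hasPred {L} (pres-cov c)

  pres-hasSucc : ∀ {x} → HasSucc M x → HasSucc L (e x)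
  pres-hasSucc (z , l , g) = cov⇒hasSucc {L} (pres-cov (l , λ w a b → g w b a))

conv-id : ∀ {L} → Conv L L id
conv-id = record { pres = id ; refl⁻ = id ; conv = λ w _ _ → w , refl }

conv-∘ : ∀ {K M L e f} → Conv M L f → Conv K M e → Conv K L (f ∘ e)
conv-∘ {K} {M} {L} {e} {f} F E = record
  { pres = F.pres ∘ E.pres ; refl⁻ = E.refl⁻ ∘ F.refl⁻ ; conv = conv }
  where
  module F = Conv F
  module E = Conv E
  conv : ∀ {x y} w → f (e x) ≺[ L ] w → w ≺[ L ] f (e y) → Σ (Carrier K) λ z → f (e z) ≡ w
  conv w a b with F.conv w a b
  ... | z , refl with E.conv z (F.refl⁻ a) (F.refl⁻ b)
  ... | z′ , refl = z′ , refl

conv-op : ∀ {M L e} → Conv M L e → Conv (M *) (L *) e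
conv-op E = record { pres = pres ; refl⁻ = refl⁻ ; conv = λ w a b → conv w b a }
  where open Conv E

conv-inj₁ : ∀ {M N} → Conv M (M ⊕ N) inj₁
conv-inj₁ = record { pres = l<l ; refl⁻ = λ { (l<l l) → l } ; conv = λ { (inj₁ w) _ _ → w , refl ; (inj₂ w) _ () } }

conv-inj₂ : ∀ {M N} → Conv N (M ⊕ N) inj₂
conv-inj₂ = record { pres = r<r ; refl⁻ = λ { (r<r l) → l } ; conv = λ { (inj₂ w) _ _ → w , refl ; (inj₁ w) () _ } }

conv-Σω : ∀ {T} i → Conv (T i) (Σω T) (i ,_)
conv-Σω {T} i = record
  { pres = inn
  ; refl⁻ = λ { (idx l) → ⊥-elim (<-irrefl refl l) ; (inn l) → l }
  ; conv = λ { w (idx l) (idx l′) → ⊥-elim (<-asym l l′)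
             ; w (idx l) (inn _)  → ⊥-elim (<-irrefl refl l)
             ; w (inn _) _        → _ , refl } }

conv-∷ : ∀ {a} n → Conv (ωPow a) (ωPow (suc a)) (n ∷_)
conv-∷ n = record
  { pres = λ l → inj₂ (refl , l)
  ; refl⁻ = λ { (inj₁ l) → ⊥-elim (<-irrefl refl l) ; (inj₂ (_ , l)) → l }
  ; conv = λ { (m ∷ w) (inj₁ l) (inj₁ l′) → ⊥-elim (<-asym l l′)
             ; (m ∷ w) (inj₁ l) (inj₂ (refl , _)) → ⊥-elim (<-irrefl refl l)
             ; (m ∷ w) (inj₂ (refl , _)) _ → w , refl } }

𝟘 : ∀ {a} → Vec ℕ a
𝟘 = replicate _ 0

𝟘-min : ∀ {a} (v : Vec ℕ a) → 𝟘 ≼[ ωPow a ] v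
𝟘-min (n ∷ v) (inj₂ (refl , l)) = 𝟘-min v l

≡𝟘⊎𝟘< : ∀ {a} (v : Vec ℕ a) → v ≡ 𝟘 ⊎ lex 𝟘 v
≡𝟘⊎𝟘< {a} v with lex-cmp 𝟘 v
... | inj₁ l           = inj₂ l
... | inj₂ (inj₁ refl) = inj₁ refl
... | inj₂ (inj₂ l)    = ⊥-elim (𝟘-min v l)

-- The next point is obtained by adding one to the last coordinate.
lex-cov : ∀ {a} (v : Vec ℕ (suc a)) → Σ (Vec ℕ (suc a)) (Cov (ωPow (suc a)) v)
lex-cov {zero} (n ∷ []) = suc n ∷ [] , inj₁ ≤-refl , λ
  { (m ∷ []) (inj₁ a) (inj₁ b) → <-irrefl refl (≤-trans b a)
  ; (m ∷ []) (inj₁ a) (inj₂ (_ , ())) ; (m ∷ []) (inj₂ (_ , ())) _ }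
lex-cov {suc a} (n ∷ v) = let v′ , c = lex-cov v in n ∷ v′ , Conv.pres-cov (conv-∷ n) c

ωPow-hasSucc : ∀ {a} v → HasSucc (ωPow (suc a)) v
ωPow-hasSucc {a} v = cov⇒hasSucc {ωPow (suc a)} (proj₂ (lex-cov v))

record Sup {M L : LO} (e : Carrier M → Carrier L) (x : Carrier L) : Set where
  field
    above : ∀ v → e v ≺[ L ] x
    cof   : ∀ z → z ≺[ L ] x → Σ (Carrier M) λ v → z ≼[ L ] e v

module _ {L} (lin : Lin L) where
  open Lin lin

  sup-∷ : ∀ {a} {e : Vec ℕ (suc a) → Carrier L} → Conv (ωPow (suc a)) L e → ∀ n →
    Sup {ωPow a} {L} (e ∘ (n ∷_)) (e (suc n ∷ 𝟘))
  sup-∷ {a} {e} E n = record { above = λ v → pres (inj₁ ≤-refl) ; cof = cof }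
    where
    open Conv E
    below : ∀ s → lex (n ∷ 𝟘) s → lex s (suc n ∷ 𝟘) → Σ (Vec ℕ a) λ v → n ∷ v ≡ s
    below (m ∷ s) (inj₁ l) (inj₁ l′)          = ⊥-elim (<-irrefl refl (≤-trans l′ l))
    below (m ∷ s) (inj₁ l) (inj₂ (refl , l′)) = ⊥-elim (𝟘-min s l′)
    below (m ∷ s) (inj₂ (refl , l)) _         = s , refl
    cof : ∀ z → z ≺[ L ] e (suc n ∷ 𝟘) → Σ (Vec ℕ a) λ v → z ≼[ L ] e (n ∷ v)
    -- Up to the start of block `n` any point of the block will do; beyond it, convexity puts `z`
    -- inside the block.
    cof z l with ≼-split z (e (n ∷ 𝟘))
    ... | inj₁ z≼ = 𝟘 , z≼
    ... | inj₂ ≺z with conv z ≺z l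
    ... | s , refl with below s (refl⁻ ≺z) (refl⁻ l)
    ... | v , refl = v , irr

  -- Simultaneous induction. A nonzero point of ω^(a+1) is either nonzero inside its block or the
  -- supremum of the previous block. A (k+1)-limit at the supremum of ω^a has a k-limit above `e 𝟘`
  -- and below it, and this one lies in the block.
  lim⇒< : ∀ {a} {e : Vec ℕ a → Carrier L} → Conv (ωPow a) L e → ∀ {k v} → lex 𝟘 v → Lim L k (e v) → k < a
  lim-sup⇒≤ : ∀ {a} {e : Vec ℕ a → Carrier L} → Conv (ωPow a) L e → ∀ {k x} → Sup {ωPow a} {L} e x → Lim L k x → k ≤ a

  lim⇒< {zero} E {v = []} () h
  lim⇒< {suc a} E {v = n ∷ v} p h with ≡𝟘⊎𝟘< v
  ... | inj₂ l = m≤n⇒m≤1+n (lim⇒< (conv-∘ E (conv-∷ n)) l h)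
  lim⇒< {suc a} E {v = zero ∷ v} p h | inj₁ refl = ⊥-elim (lex-irr (0 ∷ 𝟘) p)
  lim⇒< {suc a} E {v = suc n ∷ v} p h | inj₁ refl =
    s≤s (lim-sup⇒≤ (conv-∘ E (conv-∷ n)) (sup-∷ E n) h)

  lim-sup⇒≤ E {zero} s h = z≤n
  lim-sup⇒≤ {a} {e} E {suc k} s (m , h) with h (e 𝟘) (Sup.above s 𝟘)
  ... | w , 0<w , w<x , lw with Sup.cof s w w<x
  ... | v , w≼v with ≼⇒≺⊎≡ w≼v
  ... | inj₂ refl = lim⇒< E (Conv.refl⁻ E 0<w) lw
  ... | inj₁ w<v with Conv.conv E w 0<w w<v
  ... | u , refl = lim⇒< E (Conv.refl⁻ E 0<w) lw

  -- The points `suc n ∷ 𝟘` are suprema of blocks, so limits of the next lower order by induction,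
  -- and they are cofinal below `x`.
  sup⇒lim : ∀ {a} {e : Vec ℕ a → Carrier L} → Conv (ωPow a) L e → ∀ {x} → Sup {ωPow a} {L} e x → Lim L a x
  sup⇒lim {zero} {e} E s = e [] , Sup.above s []
  sup⇒lim {suc a} {e} E {x} s = (e 𝟘 , Sup.above s 𝟘) , step
    where
    step : ∀ z → z ≺[ L ] x → Σ (Carrier L) λ w → z ≺[ L ] w × w ≺[ L ] x × Lim L a w
    step z l with Sup.cof s z l
    ... | n ∷ v , z≼ = e (suc n ∷ 𝟘) , ≼≺-tr z≼ (Conv.pres E (inj₁ ≤-refl)) , Sup.above s _ ,
                       sup⇒lim (conv-∘ E (conv-∷ n)) (sup-∷ E n)

  lim-∷𝟘 : ∀ {a} {e : Vec ℕ (suc a) → Carrier L} → Conv (ωPow (suc a)) L e → ∀ n → Lim L a (e (suc n ∷ 𝟘))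
  lim-∷𝟘 E n = sup⇒lim (conv-∘ E (conv-∷ n)) (sup-∷ E n)

  near-ω : ∀ {e : Vec ℕ 1 → Carrier L} → Conv (ωPow 1) L e → ∀ v → Near L (e 𝟘) (e v)
  near-ω {e} E (zero ∷ [])  = near-refl lin (e 𝟘)
  near-ω {e} E (suc n ∷ []) =
    near-trans lin (near-ω E (n ∷ [])) (cov⇒near lin (Conv.pres-cov E (proj₂ (lex-cov (n ∷ [])))))

  -- Nothing is known about what precedes `e 𝟘`, so points of the first copy of ω are only compared
  -- with it; later points lie near above a limit inside the block.
  near⊎based : ∀ {a} {e : Vec ℕ a → Carrier L} → Conv (ωPow a) L e → ∀ v → Near L (e 𝟘) (e v) ⊎ Based L (e v)
  near⊎based {zero} {e} E [] = inj₁ (near-refl lin (e []))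
  near⊎based {suc zero} E v = inj₁ (near-ω E v)
  near⊎based {suc (suc a)} E (n ∷ v) with near⊎based (conv-∘ E (conv-∷ n)) v
  ... | inj₂ g = inj₂ g
  near⊎based {suc (suc a)} E (zero ∷ v)  | inj₁ f = inj₁ f
  near⊎based {suc (suc a)} E (suc n ∷ v) | inj₁ f =
    inj₂ (based-near lin (¬hasPred⇒based lin (lim⇒¬hasPred lin a (lim-∷𝟘 E n))) f)

  based-ωPow : ∀ {a} {e : Vec ℕ a → Carrier L} → Conv (ωPow a) L e → Based L (e 𝟘) → ∀ v → Based L (e v)
  based-ωPow E b v with near⊎based E v
  ... | inj₁ f = based-near lin b f
  ... | inj₂ g = g

  hasSucc-ωPow : ∀ {a} {e : Vec ℕ (suc a) → Carrier L} → Conv (ωPow (suc a)) L e → ∀ v → HasSucc L (e v)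
  hasSucc-ωPow E v = Conv.pres-hasSucc E (ωPow-hasSucc v)

-- Cutting a sum at a definable place

-- `descending` recognises a head (ω*)^(a+1). `withLastBased` tells ω + ω* from the other heads
-- ω^(a+1) that are followed by a descending term.
hasMin descending unsucceededBelow withLastBased unbasedPoint : Form 0
hasMin            = ex (all (le v1 v0))
descending        = all (ex (le v0 v1 ∧′ all (le v0 v1 ⇒′ at hasPred v0)))
unsucceededBelow  = all (ex (lt v0 v1 ∧′ neg (at hasSucc v0)))
withLastBased     = ex (all (le v0 v1 ⇒′ at based v0) ∧′ neg (at hasSucc v0))
unbasedPoint      = ex (neg (at based v0))

-- `limInBased k` shows whether the term after a head ω^k has a least point; `limBeforeBased k`,
-- read in the reversed sum, whether the term after a head (ω*)^k is again descending.
cofinalLim limInBased limBeforeBased limPoint : ℕ → Form 0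
cofinalLim k      = all (ex (lt v1 v0 ∧′ at (isLim k) v0))
limInBased k      = ex (at (isLim k) v0 ∧′ all (le v0 v1 ⇒′ at based v0))
limBeforeBased k  = ex (at (isLim k) v0 ∧′ all (le v1 v0 ⇒′ at based v0))
limPoint k        = ex (at (isLim k) v0)

afterUnbased : Form 1
afterUnbased = ex (le v0 v1 ∧′ neg (at based v0))

afterLim beforeLim : ℕ → Form 1
afterLim k  = ex (le v0 v1 ∧′ at (isLim k) v0)
beforeLim k = ex (lt v1 v0 ∧′ at (isLim k) v0)

-- Meant for orders ending in ω* + ω^(a+1): the unbased points of this end lie in one copy of ω* +
-- ω, and a point precedes that copy when some unbased point above it is not near.
farBeforeUnbased : Form 1
farBeforeUnbased = ex (le v1 v0 ∧′ neg (at based v0) ∧′ neg (near v1 v0))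

_⊨_ : LO → Form 0 → Set
L ⊨ φ = eval L [] φ

infix 4 _⊨_

definesʳ : ∀ {P R} φ → (∀ r → eval (P ⊕ R) (inj₂ r ∷ []) φ) → (∀ p → ¬ eval (P ⊕ R) (inj₁ p ∷ []) φ) →
  Defines (P ⊕ R) R φ inj₂
definesʳ φ holds fails = record
  { inj = λ { refl → refl } ; pres = mk⇔ r<r (λ { (r<r l) → l }) ; sound = holds
  ; onto = λ { (inj₁ p) h → ⊥-elim (fails p h) ; (inj₂ r) h → r , refl } }

definesˡ : ∀ {P R} φ → (∀ p → eval (P ⊕ R) (inj₁ p ∷ []) φ) → (∀ r → ¬ eval (P ⊕ R) (inj₂ r ∷ []) φ) →
  Defines (P ⊕ R) P φ inj₁
definesˡ φ holds fails = record
  { inj = λ { refl → refl } ; pres = mk⇔ l<l (λ { (l<l l) → l }) ; sound = holds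
  ; onto = λ { (inj₁ p) h → p , refl ; (inj₂ r) h → ⊥-elim (fails r h) } }

-- Cuts that `Near` does not cross

Gap : LO → LO → Set
Gap P Q = ∀ p q → ¬ Near (P ⊕ Q) (inj₁ p) (inj₂ q)

-- The greatest point of `P` would need a successor, which would be a least point of `Q`.
gap-max : ∀ {P Q} → P * ⊨ hasMin → (∀ q → Σ (Carrier Q) λ q′ → q′ ≺[ Q ] q) → Gap P Q
gap-max {P} {Q} (m , top) noMin p q (_ , _ , s) with s (inj₁ m) (λ { (l<l l) → top p l }) l<r
... | inj₁ x , l<l l , _ = top x l
... | inj₂ x , l<r , g = g (inj₂ (proj₁ (noMin x))) (r<r (proj₂ (noMin x))) l<r

-- Read in `P *`, the hypothesis puts points without predecessor above every point of `P`, hence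
-- between `p` and `q`.
gap-limits : ∀ {P Q} → P * ⊨ unsucceededBelow → Gap P Q
gap-limits {P} {Q} lims p q (_ , h , _) with lims p
... | w , p<w , nw with h (inj₁ w) (l<l p<w) (λ ())
... | inj₁ x , l<l l , g = nw (x , l , λ u a b → g (inj₁ u) (l<l a) (l<l b))

gap-unsucceeded : ∀ {P Q} → Q ⊨ unsucceededBelow → Gap P Q
gap-unsucceeded {P} {Q} h p q (_ , _ , s) with h q
... | w , w<q , nw with s (inj₂ w) (λ ()) (r<r w<q)
... | inj₂ x , r<r l , g = nw (x , l , λ u a b → g (inj₂ u) (r<r a) (r<r b))

module _ {R} (lR : Lin R) where
  descending⇒noMin : R ⊨ descending → ∀ r → Σ (Carrier R) λ r′ → r′ ≺[ R ] r
  descending⇒noMin d r =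
    let y , y≼r , h = d r ; z , z<y , _ = h y (Lin.irr lR) in z , Lin.≺≼-tr lR z<y y≼r

ω*Pow-hasPred : ∀ {L} {a} {e : Vec ℕ (suc a) → Carrier L} → Lin L → Conv (ω*Pow (suc a)) L e → ∀ v → HasPred L (e v)
ω*Pow-hasPred {L} lL E v = hasSucc-ωPow {L *} (op-lin lL) (conv-op E) v

near-ω* : ∀ {L} {e : Vec ℕ 1 → Carrier L} → Lin L → Conv (ω*Pow 1) L e → ∀ v → Near L (e v) (e 𝟘)
near-ω* {L} lL E v = near-op {L *} (near-ω {L *} (op-lin lL) (conv-op E) v)

module Descending {P R} (lP : Lin P) (lR : Lin R) (gap : Gap P R) (desc : R ⊨ descending) where
  private
    L = P ⊕ R
    lL = ⊕-lin lP lR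

  -- A point without predecessor near below `y` cannot lie in `P` because of the gap, nor in `R`,
  -- where everything up to `y` has a predecessor.
  unbased-below : ∀ r → Σ (Carrier R) λ y → y ≼[ R ] r × ¬ Based L (inj₂ y)
  unbased-below r with desc r
  ... | y , y≼r , h = y , y≼r , λ
    { (inj₁ p , _ , n)  → gap p y n
    ; (inj₂ q , np , (l , _)) → np (Conv.pres-hasPred conv-inj₂ (h q (λ a → l (r<r a)))) }

  ≼-inj₂ : ∀ {x y} → x ≼[ R ] y → inj₂ x ≼[ L ] inj₂ y
  ≼-inj₂ a (r<r l) = a l

  defines-afterUnbased : (∀ p → Based L (inj₁ p)) → Defines L R afterUnbased inj₂
  defines-afterUnbased b = definesʳ afterUnbased
    (λ r → let y , y≼r , nb = unbased-below r in inj₂ y , ≼-inj₂ y≼r , nb)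
    (λ { p (inj₁ q , _ , nb) → nb (b q) ; p (inj₂ q , l , _) → l l<r })

  ¬limInBased : ∀ k → (∀ p → ¬ Lim L k (inj₁ p)) → ¬ (L ⊨ limInBased k)
  ¬limInBased k nl (inj₁ p , l , _) = nl p l
  ¬limInBased k nl (inj₂ r , _ , b) =
    let y , y≼r , nb = unbased-below r in nb (b (inj₂ y) (≼-inj₂ y≼r))

  ¬withLastBased : (∀ p → HasSucc L (inj₁ p)) → ¬ (L ⊨ withLastBased)
  ¬withLastBased s (inj₁ p , _ , ns) = ns (s p)
  ¬withLastBased s (inj₂ r , b , _) =
    let y , y≼r , nb = unbased-below r in nb (b (inj₂ y) (≼-inj₂ y≼r))

module OrdinalHead {R} (lR : Lin R) (a : ℕ) where
  private
    L = ωPow a ⊕ R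
    lL = ⊕-lin (ωPow-lin a) lR

  least : ∀ x → inj₁ 𝟘 ≼[ L ] x
  least (inj₁ v) (l<l l) = 𝟘-min v l

  based-head : ∀ v → Based L (inj₁ v)
  based-head = based-ωPow lL conv-inj₁ (¬hasPred⇒based lL λ (z , l , _) → least z l)

  ¬lim-head : ∀ {k} → a ≤ k → ∀ v → ¬ Lim L k (inj₁ v)
  ¬lim-head {k} a≤k v h with ≡𝟘⊎𝟘< v
  ... | inj₁ refl = let z , l = lim-≤ lL {k = k} z≤n h in least z l
  ... | inj₂ l    = <-irrefl refl (<-≤-trans (lim⇒< lL conv-inj₁ l h) a≤k)

  module _ (min : R ⊨ hasMin) where
    private
      r₀ = proj₁ min

    lim-next : Lim L a (inj₂ r₀)
    lim-next = sup⇒lim lL conv-inj₁ record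
      { above = λ _ → l<r
      ; cof = λ { (inj₁ v) _ → v , Lin.irr lL ; (inj₂ r) (r<r l) → ⊥-elim (proj₂ min r l) } }

    defines-afterLim : Defines L R (afterLim a) inj₂
    defines-afterLim = definesʳ (afterLim a)
      (λ r → inj₂ r₀ , (λ { (r<r l) → proj₂ min r l }) , lim-next)
      (λ { p (inj₁ q , _ , h) → ¬lim-head ≤-refl q h ; p (inj₂ q , l , _) → l l<r })

module _ {R} (lR : Lin R) where
  private
    module H a = OrdinalHead lR a

  1+-based : ∀ {r₀} → (∀ r → r₀ ≼[ R ] r) → Based (ωPow 0 ⊕ R) (inj₂ r₀)
  1+-based {r₀} m = based-near lL (H.based-head 0 []) (cov⇒near lL (l<r , λ
    { (inj₁ []) (l<l ()) _ ; (inj₂ r) _ (r<r l) → m r l }))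
    where lL = ⊕-lin (ωPow-lin 0) lR

  limInBased-head : ∀ a → R ⊨ hasMin → ωPow a ⊕ R ⊨ limInBased a
  limInBased-head a (r₀ , m) = inj₂ r₀ , H.lim-next a (r₀ , m) , initial a
    where
    next : ∀ a → Based (ωPow a ⊕ R) (inj₂ r₀)
    -- After ω^0 the least point of `R` is a successor and inherits `Based`; after ω^(a+1) it is a
    -- limit.
    next zero    = 1+-based m
    next (suc a) = ¬hasPred⇒based lL (lim⇒¬hasPred lL a (H.lim-next (suc a) (r₀ , m)))
      where lL = ⊕-lin (ωPow-lin (suc a)) lR
    initial : ∀ a y → y ≼[ ωPow a ⊕ R ] inj₂ r₀ → Based (ωPow a ⊕ R) y
    initial a (inj₁ v) _ = H.based-head a v
    initial a (inj₂ r) l with Lin.≼⇒≺⊎≡ lR {r} {r₀} (λ k → l (r<r k))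
    ... | inj₁ k    = ⊥-elim (m r k)
    ... | inj₂ refl = next a

-- ω ⊕ ω* at the beginning of an order behaves like a finite order.
module FiniteLike {R} (lR : Lin R) (desc : R ⊨ descending) where
  private
    P = ωPow 1 ⊕ ω*Pow 1
    lP = ⊕-lin (ωPow-lin 1) (op-lin (ωPow-lin 1))
    L = P ⊕ R
    lL = ⊕-lin lP lR

    convω : Conv (ωPow 1) L (λ v → inj₁ (inj₁ v))
    convω = conv-∘ conv-inj₁ conv-inj₁

    convω* : Conv (ω*Pow 1) L (λ v → inj₁ (inj₂ v))
    convω* = conv-∘ conv-inj₁ conv-inj₂

  top : ∀ p → p ≼[ P ] inj₂ 𝟘
  top (inj₂ v) (r<r l) = 𝟘-min v l

  gap : Gap P R
  gap = gap-max (inj₂ 𝟘 , top) (descending⇒noMin lR desc)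

  open Descending lP lR gap desc public

  pred : ∀ p → inj₁ 𝟘 ≺[ P ] p → HasPred L (inj₁ p)
  pred (inj₁ (zero ∷ [])) (l<l l)  = ⊥-elim (lex-irr (0 ∷ []) l)
  pred (inj₁ (suc n ∷ [])) _ = Conv.pres-hasPred convω (n ∷ [] , proj₂ (lex-cov (n ∷ [])))
  pred (inj₂ v) _ = ω*Pow-hasPred lL convω* v

  succ : ∀ p → p ≺[ P ] inj₂ 𝟘 → HasSucc L (inj₁ p)
  succ (inj₁ v) _ = hasSucc-ωPow lL convω v
  succ (inj₂ (zero ∷ [])) (r<r l) = ⊥-elim (lex-irr (0 ∷ []) l)
  succ (inj₂ (suc n ∷ [])) _ =
    Conv.pres-hasPred (conv-op convω*) (n ∷ [] , proj₂ (lex-cov (n ∷ [])))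

  -- Every point but the first has a predecessor and every point but the last a successor, so all of
  -- ω + ω* is near its first point.
  all-based : ∀ p → Based L (inj₁ p)
  all-based p = inj₁ (inj₁ 𝟘) , (λ (z , l , _) → bot z l) , bot (inj₁ p) ,
    (λ { (inj₁ q) (l<l l) _ → pred q l ; (inj₂ r) _ k → ⊥-elim (k l<r) }) ,
    (λ { (inj₁ q) _ (l<l l) → succ q (Lin.≺≼-tr lP l (top p)) ; (inj₂ r) _ () })
    where
    bot : ∀ x → inj₁ (inj₁ 𝟘) ≼[ L ] x
    bot (inj₁ (inj₁ v)) (l<l (l<l l)) = 𝟘-min v l

  ¬lim : ∀ p → ¬ Lim L 1 (inj₁ p)
  ¬lim p h with Lin.cmp lP (inj₁ 𝟘) p
  ... | inj₁ l = lim⇒¬hasPred lL 0 h (pred p l)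
  ¬lim p h | inj₂ (inj₁ refl) with proj₁ h
  ... | inj₁ (inj₁ v) , l<l (l<l l) = 𝟘-min v l
  ¬lim p h | inj₂ (inj₂ l) with p
  ¬lim p h | inj₂ (inj₂ (l<l l)) | inj₁ v = 𝟘-min v l

  lastBased : L ⊨ withLastBased
  lastBased = inj₁ (inj₂ 𝟘) , (λ { (inj₁ p) _ → all-based p ; (inj₂ r) l → ⊥-elim (l l<r) }) , λ
    { (inj₁ p , l<l l , _) → top p l
    ; (inj₂ r , l<r , g) → let r′ , l = descending⇒noMin lR desc r in g (inj₂ r′) (r<r l) l<r }

lim-⊕ˡ : ∀ {P Q} k {p} → Lim P k p → Lim (P ⊕ Q) k (inj₁ p)
lim-⊕ˡ zero    (z , l)       = inj₁ z , l<l l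
lim-⊕ˡ (suc k) ((z , l) , h) = (inj₁ z , l<l l) , λ
  { (inj₁ z) (l<l l) → let w , a , b , c = h z l in inj₁ w , l<l a , l<l b , lim-⊕ˡ k c }

-- Orders that end in an ordinal power

module OrdinalEnd {R} (lR : Lin R) where
  private
    lL : ∀ a → Lin (R ⊕ ωPow a)
    lL a = ⊕-lin lR (ωPow-lin a)

  cofinalLim-end : ∀ {k a} → k ≤ a → R ⊕ ωPow (suc a) ⊨ cofinalLim k
  cofinalLim-end {k} {a} k≤a (inj₁ r) = _ , l<r , lim-≤ (lL _) {k = a} k≤a (lim-∷𝟘 (lL _) {a} conv-inj₂ 0)
  cofinalLim-end {k} {a} k≤a (inj₂ (n ∷ v)) =
    _ , r<r (inj₁ (n<1+n n)) , lim-≤ (lL _) {k = a} k≤a (lim-∷𝟘 (lL _) {a} conv-inj₂ n)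

  ¬lim-end : ∀ {k a} → a ≤ k → ∀ {v} → lex 𝟘 v → ¬ Lim (R ⊕ ωPow a) k (inj₂ v)
  ¬lim-end a≤k l h = <-irrefl refl (<-≤-trans (lim⇒< (lL _) conv-inj₂ l h) a≤k)

  ¬after : ∀ {k a} → a ≤ k → ∀ v → ¬ Σ (Carrier (R ⊕ ωPow a)) λ y → inj₂ v ≺[ R ⊕ ωPow a ] y × Lim (R ⊕ ωPow a) k y
  ¬after {a = a} a≤k v (inj₂ u , r<r l , h) = ¬lim-end a≤k (Lin.≼≺-tr (ωPow-lin a) {𝟘} {v} {u} (𝟘-min v) l) h

  ¬cofinalLim-end : ∀ {k a} → a ≤ k → ¬ (R ⊕ ωPow a ⊨ cofinalLim k)
  ¬cofinalLim-end a≤k h = ¬after a≤k 𝟘 (h (inj₂ 𝟘))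

  module _ (r₀ : Carrier R) {a : ℕ} (cof : R ⊨ cofinalLim a) where
    lim-join : Lim (R ⊕ ωPow (suc a)) (suc a) (inj₂ 𝟘)
    lim-join = (inj₁ r₀ , l<r) , λ
      { (inj₁ r) _ → let w , l , h = cof r in inj₁ w , l<l l , l<r , lim-⊕ˡ a h
      ; (inj₂ v) (r<r l) → ⊥-elim (𝟘-min v l) }

    -- `inj₂ 𝟘` is the last (a+1)-limit, since no nonzero point of ω^(a+1) is one.
    defines-beforeLim : Defines (R ⊕ ωPow (suc a)) R (beforeLim (suc a)) inj₁
    defines-beforeLim = definesˡ (beforeLim (suc a)) (λ r → inj₂ 𝟘 , l<r , lim-join) (¬after ≤-refl)

    limBeforeBased-end : R ⊕ ωPow (suc a) ⊨ limBeforeBased (suc a)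
    limBeforeBased-end = inj₂ 𝟘 , lim-join , λ
      { (inj₁ r) l → ⊥-elim (l l<r)
      ; (inj₂ v) _ → based-ωPow (lL _) conv-inj₂
          (¬hasPred⇒based (lL _) (lim⇒¬hasPred (lL _) a lim-join)) v }

-- Orders that end in ω* + ω^(a+1)

module ζEnd {P} (lP : Lin P) (a : ℕ) where
  private
    Q = ω*Pow 1 ⊕ ωPow (suc a)
    L = P ⊕ Q
    lQ = ⊕-lin (op-lin (ωPow-lin 1)) (ωPow-lin (suc a))
    lL = ⊕-lin lP lQ

    o : Carrier L
    o = inj₂ (inj₂ 𝟘)

    convω* : Conv (ω*Pow 1) L (λ v → inj₂ (inj₁ v))
    convω* = conv-∘ conv-inj₂ conv-inj₁

    convω : Conv (ωPow (suc a)) L (λ v → inj₂ (inj₂ v))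
    convω = conv-∘ conv-inj₂ conv-inj₂

    centre : Cov L (inj₂ (inj₁ 𝟘)) o
    centre = r<r l<r , λ
      { (inj₂ (inj₁ v)) (r<r (l<l l)) _ → 𝟘-min v l ; (inj₂ (inj₂ v)) _ (r<r (r<r l)) → 𝟘-min v l }

  module _ (gap : Gap P Q) where
    -- Both `o` and all points of ω* have predecessors, and the gap keeps the points of `P` out of
    -- reach.
    ¬based-centre : ¬ Based L o
    ¬based-centre (inj₁ p , _ , n) = gap p _ n
    ¬based-centre (inj₂ (inj₁ v) , np , _) = np (ω*Pow-hasPred lL convω* v)
    ¬based-centre (inj₂ (inj₂ v) , np , l , _) with ≡𝟘⊎𝟘< v
    ... | inj₁ refl = np (cov⇒hasPred {L} centre)
    ... | inj₂ k    = l (r<r (r<r k))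

    -- By `near⊎based` an unbased point of ω^(a+1) is near `o`, and so is every point of ω*.
    near-unbased : ∀ q w → inj₂ q ≼[ L ] w → ¬ Based L w → Near L (inj₂ q) w
    near-unbased q (inj₁ p) l _ = ⊥-elim (l l<r)
    near-unbased (inj₁ v) (inj₂ (inj₁ u)) l _ =
      near-sub lL (Lin.irr lL) l (λ { (r<r (l<l k)) → 𝟘-min u k }) (near-ω* lL convω* v)
    near-unbased (inj₂ v) (inj₂ (inj₁ u)) l _ = ⊥-elim (l (r<r l<r))
    near-unbased q (inj₂ (inj₂ u)) l nb with near⊎based lL convω u
    ... | inj₂ b = ⊥-elim (nb b)
    near-unbased (inj₁ v) (inj₂ (inj₂ u)) l nb | inj₁ n =
      near-trans lL (near-ω* lL convω* v) (near-trans lL (cov⇒near lL centre) n)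
    near-unbased (inj₂ v) (inj₂ (inj₂ u)) l nb | inj₁ n =
      near-sub lL (λ { (r<r (r<r k)) → 𝟘-min v k }) l (Lin.irr lL) n

    defines-farBeforeUnbased : Defines L P farBeforeUnbased inj₁
    defines-farBeforeUnbased = definesˡ farBeforeUnbased
      (λ p → o , (λ ()) , ¬based-centre , gap p _)
      (λ { q (w , l , nb , nn) → nn (near-unbased q w l nb) })

    -- A limit before `o` has the unbased point `o` above it; `o` itself has a predecessor, and no
    -- point after it is an (a+1)-limit.
    ¬limBeforeBased-ζ : ¬ (L ⊨ limBeforeBased (suc a))
    ¬limBeforeBased-ζ (inj₁ p , _ , b) = ¬based-centre (b o (λ ()))
    ¬limBeforeBased-ζ (inj₂ (inj₁ v) , _ , b) = ¬based-centre (b o (λ { (r<r ()) }))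
    ¬limBeforeBased-ζ (inj₂ (inj₂ v) , h , b) with ≡𝟘⊎𝟘< v
    ... | inj₁ refl = lim⇒¬hasPred lL a h (cov⇒hasPred {L} centre)
    ... | inj₂ k    = <-irrefl refl (lim⇒< lL convω k h)

-- Special monomial sums

-- desc a stands for (ω*)^(a+1), so that the one-point order has the single code asc 0.
data Term : Set where
  asc desc : ℕ → Term

⟪_⟫ : Term → LO
⟪ asc a ⟫  = ωPow a
⟪ desc a ⟫ = ω*Pow (suc a)

Terms : Set
Terms = ℕ → Term

opaque
  S : Terms → LO
  S k = Σω (λ i → ⟪ k i ⟫)

tl : Terms → Terms
tl k i = k (suc i)

-- Where this fails, one term absorbs the other: ω^a vanishes into a larger ω^b on its right, and
-- (ω*)^b, a single point included, into a larger (ω*)^a on its left.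
Step : Term → Term → Set
Step (asc a)  (asc b)  = b ≤ a
Step (asc a)  (desc b) = ⊤
Step (desc a) (asc b)  = 1 ≤ b
Step (desc a) (desc b) = a ≤ b

record Good (k : Terms) : Set where
  field
    step  : ∀ i → Step (k i) (k (suc i))
    spec₁ : ∀ i → k i ≡ asc 1 → k (suc i) ≡ desc 0 → ∀ m → 1 ≤ m → ¬ k (suc (suc i)) ≡ asc m
    spec₂ : ∀ i m → k i ≡ desc m → k (suc i) ≡ asc 1 → ¬ k (suc (suc i)) ≡ desc 0

tl-good : ∀ {k} → Good k → Good (tl k)
tl-good g = record { step = step ∘ suc ; spec₁ = spec₁ ∘ suc ; spec₂ = spec₂ ∘ suc }
  where open Good g

term-lin : ∀ x → Lin ⟪ x ⟫
term-lin (asc a)  = ωPow-lin a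
term-lin (desc a) = op-lin (ωPow-lin (suc a))

opaque
  unfolding S

  S-lin : ∀ k → Lin (S k)
  S-lin k = Σω-lin (λ i → term-lin (k i))

  point : ∀ k → Carrier (S k)
  point k = 0 , pt (k 0)
    where
    pt : ∀ x → Carrier ⟪ x ⟫
    pt (asc a)  = 𝟘
    pt (desc a) = 𝟘

  split : ∀ k {x} → k 0 ≡ x → S k ≅ ⟪ x ⟫ ⊕ S (tl k)
  split k refl = Σω-split (λ i → ⟪ k i ⟫)

  S≅Σω : ∀ {k T} → (∀ i → ⟪ k i ⟫ ≅ T i) → S k ≅ Σω T
  S≅Σω = Σω-cong

S*-lin : ∀ k → Lin (S k *)
S*-lin k = op-lin (S-lin k)

split* : ∀ k {a} → k 0 ≡ desc a → S k * ≅ S (tl k) * ⊕ ωPow (suc a)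
split* k {a} e = ≅-trans (≅-op (split k e)) (op-⊕ (ω*Pow (suc a)) (S (tl k)))

asc-hasMin : ∀ k {a} → k 0 ≡ asc a → S k ⊨ hasMin
asc-hasMin k {a} e = ≅-sentence hasMin (split k e) (inj₁ 𝟘 , OrdinalHead.least (S-lin (tl k)) a)

module _ {R} (lR : Lin R) {a : ℕ} where
  private
    L = ω*Pow (suc a) ⊕ R
    lL = ⊕-lin (op-lin (ωPow-lin (suc a))) lR

  descending-ω*Pow⊕ : L ⊨ descending
  descending-ω*Pow⊕ x = inj₁ (below x) , below-≼ x , λ
    { (inj₁ u) _ → ω*Pow-hasPred lL conv-inj₁ u ; (inj₂ r) l → ⊥-elim (l l<r) }
    where
    below : Carrier L → Vec ℕ (suc a)
    below (inj₁ v) = v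
    below (inj₂ r) = 𝟘
    below-≼ : ∀ x → inj₁ (below x) ≼[ L ] x
    below-≼ (inj₁ v) = Lin.irr lL
    below-≼ (inj₂ r) ()

-- The points `suc n ∷ 𝟘` are limits in the reversed order, so they have no successor here, and they
-- go below every point.
unsucceededBelow-ω*Pow⊕ : ∀ {R} → Lin R → ∀ a → ω*Pow (suc (suc a)) ⊕ R ⊨ unsucceededBelow
unsucceededBelow-ω*Pow⊕ {R} lR a x = inj₁ (suc (lead x) ∷ 𝟘) , below x , ns (lead x)
  where
  L = ω*Pow (suc (suc a)) ⊕ R
  lL = ⊕-lin (op-lin (ωPow-lin (suc (suc a)))) lR
  lead : Carrier L → ℕ
  lead (inj₁ (n ∷ _)) = n
  lead (inj₂ _)       = 0
  below : ∀ x → inj₁ (suc (lead x) ∷ 𝟘) ≺[ L ] x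
  below (inj₁ (n ∷ _)) = l<l (inj₁ ≤-refl)
  below (inj₂ _)       = l<r
  ns : ∀ n → ¬ HasSucc L (inj₁ (suc n ∷ 𝟘))
  ns n = lim⇒¬hasPred {L *} (op-lin lL) a (lim-∷𝟘 {L *} (op-lin lL) (conv-op conv-inj₁) n)

desc-descending : ∀ k {a} → k 0 ≡ desc a → S k ⊨ descending
desc-descending k e = ≅-sentence descending (split k e) (descending-ω*Pow⊕ (S-lin (tl k)))

desc-unsucceededBelow : ∀ k {a} → k 0 ≡ desc (suc a) → S k ⊨ unsucceededBelow
desc-unsucceededBelow k e =
  ≅-sentence unsucceededBelow (split k e) (unsucceededBelow-ω*Pow⊕ (S-lin (tl k)) _)

desc-cofinalLim : ∀ k {a j} → k 0 ≡ desc a → j ≤ a → S k * ⊨ cofinalLim j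
desc-cofinalLim k {j = j} e j≤a =
  ≅-sentence (cofinalLim j) (split* k e) (OrdinalEnd.cofinalLim-end (S*-lin (tl k)) j≤a)

¬desc-hasMin : ∀ k {a} → k 0 ≡ desc a → ¬ (S k ⊨ hasMin)
¬desc-hasMin k e (m , h) =
  let z , l = descending⇒noMin (S-lin k) (desc-descending k e) m in h z l

-- Unless the sum starts with ω + ω*, the place where the initial ordinal ends is visible.
head-gap : ∀ k {a b} → k 0 ≡ asc a → k 1 ≡ desc b → (a ≡ 1 × b ≡ 0) ⊎ Gap (ωPow a) (S (tl k))
head-gap k {zero} e e′ = inj₂ (gap-max ([] , λ { [] () })
  (descending⇒noMin (S-lin (tl k)) (desc-descending (tl k) e′)))
head-gap k {a = suc zero} {zero} e e′  = inj₁ (refl , refl)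
head-gap k {a = suc zero} {suc b} e e′ = inj₂ (gap-unsucceeded (desc-unsucceededBelow (tl k) e′))
head-gap k {a = suc (suc a)} e e′ = inj₂ (gap-limits λ
  { (n ∷ v) → suc n ∷ 𝟘 , inj₁ ≤-refl ,
      lim⇒¬hasPred (ωPow-lin _) a (lim-∷𝟘 (ωPow-lin _) {suc a} conv-id n) })

module _ {k} (g : Good k) (e : k 0 ≡ asc 1) (e′ : k 1 ≡ desc 0) where
  -- After ω + ω* the special condition forbids ω^m with m ≥ 1, and ω^0 would be absorbed by ω*.
  glued-next : S (tl (tl k)) ⊨ descending
  glued-next with k 2 in e″ | Good.step g 1
  ... | desc b | _ = desc-descending (tl (tl k)) e″
  ... | asc b  | s = ⊥-elim (Good.spec₁ g 0 e e′ b (subst (λ x → Step x (asc b)) e′ s) e″)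

  glued-split : S k ≅ (ωPow 1 ⊕ ω*Pow 1) ⊕ S (tl (tl k))
  glued-split = ≅-trans (split k e) (≅-trans (⊕-cong ≅-refl (split (tl k) e′)) (≅-sym (⊕-assoc _ _ _)))

  module Glued = FiniteLike (S-lin (tl (tl k))) glued-next

-- Together with `limInBased-asc` this lets the theory decide whether the term after a head ω^a is
-- ascending.
¬limInBased : ∀ {k a b} → Good k → k 0 ≡ asc a → k 1 ≡ desc b → ¬ (S k ⊨ limInBased a)
¬limInBased {k} {a} g e e′ h with head-gap k e e′
... | inj₂ gap = Descending.¬limInBased (ωPow-lin a) lR gap (desc-descending (tl k) e′) a
    (OrdinalHead.¬lim-head lR a ≤-refl) (≅-sentence (limInBased a) (≅-sym (split k e)) h)
    where lR = S-lin (tl k)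
... | inj₁ (refl , refl) = Glued.¬limInBased g e e′ 1 (Glued.¬lim g e e′)
    (≅-sentence (limInBased 1) (≅-sym (glued-split g e e′)) h)

¬withLastBased : ∀ {k a b} → k 0 ≡ asc (suc a) → k 1 ≡ desc b → Gap (ωPow (suc a)) (S (tl k)) → ¬ (S k ⊨ withLastBased)
¬withLastBased {k} e e′ gap h =
  Descending.¬withLastBased (ωPow-lin _) lR gap (desc-descending (tl k) e′)
    (hasSucc-ωPow (⊕-lin (ωPow-lin _) lR) conv-inj₁) (≅-sentence withLastBased (≅-sym (split k e)) h)
  where lR = S-lin (tl k)

limInBased-asc : ∀ {k a b} → k 0 ≡ asc a → k 1 ≡ asc b → S k ⊨ limInBased a
limInBased-asc {k} {a} e e′ =
  ≅-sentence (limInBased a) (split k e) (limInBased-head (S-lin (tl k)) a (asc-hasMin (tl k) e′))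

-- Cancelling a common head ω^a

asc-cancel : ∀ {k l a} c d → Good k → Good l → k 0 ≡ asc a → l 0 ≡ asc a → k 1 ≡ c → l 1 ≡ d →
  S k ≡ₑ S l → S (tl k) ≡ₑ S (tl l)
asc-cancel {k} {l} {a} (asc c) (asc d) g h ek el ek′ el′ q =
  ≡ₑ-restrict (afterLim a)
    (OrdinalHead.defines-afterLim (S-lin (tl k)) a (asc-hasMin (tl k) ek′))
    (OrdinalHead.defines-afterLim (S-lin (tl l)) a (asc-hasMin (tl l) el′))
    (≡ₑ-resp-≅ (split k ek) (split l el) q)
asc-cancel {a = a} (asc c) (desc d) g h ek el ek′ el′ q =
  ⊥-elim (¬limInBased h el el′ (≡ₑ-sentence (limInBased a) q (limInBased-asc ek ek′)))
asc-cancel {a = a} (desc c) (asc d) g h ek el ek′ el′ q =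
  ⊥-elim (¬limInBased g ek ek′ (≡ₑ-sentence (limInBased a) (≡ₑ-sym q) (limInBased-asc el el′)))
asc-cancel {k} {l} {a} (desc c) (desc d) g h ek el ek′ el′ q with head-gap k ek ek′ | head-gap l el el′
... | inj₂ gk | inj₂ gl =
  ≡ₑ-restrict afterUnbased
    (Descending.defines-afterUnbased (ωPow-lin a) (S-lin (tl k)) gk (desc-descending (tl k) ek′)
      (OrdinalHead.based-head (S-lin (tl k)) a))
    (Descending.defines-afterUnbased (ωPow-lin a) (S-lin (tl l)) gl (desc-descending (tl l) el′)
      (OrdinalHead.based-head (S-lin (tl l)) a))
    (≡ₑ-resp-≅ (split k ek) (split l el) q)
-- The cut inside ω + ω* is hidden, so both terms are removed and ω* is put back.
... | inj₁ (refl , refl) | inj₁ (refl , refl) =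
  ≡ₑ-resp-≅ (≅-sym (split (tl k) ek′)) (≅-sym (split (tl l) el′)) (⊕-congʳ-≡ₑ (ω*Pow 1) (point (tl (tl k)))
    (≡ₑ-restrict afterUnbased
      (Glued.defines-afterUnbased g ek ek′ (Glued.all-based g ek ek′))
      (Glued.defines-afterUnbased h el el′ (Glued.all-based h el el′))
      (≡ₑ-resp-≅ (glued-split g ek ek′) (glued-split h el el′) q)))
-- The cut cannot be hidden in one sum and visible in the other: `withLastBased` would separate
-- them.
... | inj₁ (refl , refl) | inj₂ gl = ⊥-elim (¬withLastBased {l} el el′ gl
  (≡ₑ-sentence withLastBased q
    (≅-sentence withLastBased (glued-split g ek ek′) (Glued.lastBased g ek ek′))))
... | inj₂ gk | inj₁ (refl , refl) = ⊥-elim (¬withLastBased {k} ek ek′ gk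
  (≡ₑ-sentence withLastBased (≡ₑ-sym q)
    (≅-sentence withLastBased (glued-split h el el′) (Glued.lastBased h el el′))))

-- Sums of ordinal powers only, compared with a sum whose head ω^b exceeds all of them

module AllAsc (k : Terms) (c : ℕ → ℕ) (asc≡ : ∀ i → k i ≡ asc (c i)) (step : ∀ i → c (suc i) ≤ c i) where
  private
    T : LO
    T = Σω (λ i → ωPow (c i))
    lT : Lin T
    lT = Σω-lin (λ i → ωPow-lin (c i))

  S≅T : S k ≅ T
  S≅T = S≅Σω λ i → subst (λ x → ⟪ k i ⟫ ≅ ⟪ x ⟫) (asc≡ i) ≅-refl

  private
    sup-next : ∀ i → Sup {ωPow (c i)} {T} (i ,_) (suc i , 𝟘)
    sup-next i = record
      { above = λ v → idx ≤-refl
      ; cof = λ { (j , v) (idx (s≤s l)) → cof j v l ; (j , v) (inn l) → ⊥-elim (𝟘-min v l) } }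
      where
      cof : ∀ j v → j ≤ i → Σ (Vec ℕ (c i)) λ u → (j , v) ≼[ T ] (i , u)
      cof j v j≤i with m≤n⇒m<n∨m≡n j≤i
      ... | inj₁ l    = 𝟘 , Lin.≺⇒≼ lT (idx l)
      ... | inj₂ refl = v , Lin.irr lT

    -- After a positive power the next term starts at a limit, after ω^0 at a successor of a based
    -- point.
    based-next : ∀ i a (p : c i ≡ a) → Based T (i , 𝟘) → Based T (suc i , 𝟘)
    based-next i (suc a) p b = ¬hasPred⇒based lT
      (lim⇒¬hasPred lT a (subst (λ x → Lim T x (suc i , 𝟘)) p (sup⇒lim lT (conv-Σω i) (sup-next i))))
    based-next i zero p b = based-near lT b (cov⇒near lT (idx ≤-refl , between))
      where
      unique : ∀ {m} → m ≡ 0 → (u v : Vec ℕ m) → ¬ lex u v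
      unique refl [] [] ()
      between : ∀ w → (i , 𝟘) ≺[ T ] w → w ≺[ T ] (suc i , 𝟘) → ⊥
      between (j , v) (idx l) (idx l′) = <-irrefl refl (≤-trans l′ l)
      between (j , v) (idx l) (inn l′) = 𝟘-min v l′
      between (j , v) (inn l) _        = unique p _ _ l

    based-first : ∀ i → Based T (i , 𝟘)
    based-first zero    = ¬hasPred⇒based lT λ { (_ , idx () , _) ; (_ , inn {x = v} l , _) → 𝟘-min v l }
    based-first (suc i) = based-next i (c i) refl (based-first i)

  ¬unbasedPoint : ¬ (S k ⊨ unbasedPoint)
  ¬unbasedPoint h with ≅-sentence unbasedPoint (≅-sym S≅T) h
  ... | (i , v) , nb = nb (based-ωPow lT (conv-Σω i) (based-first i) v)

  ¬limPoint : ∀ {b} → (∀ i → c i < b) → ¬ (S k ⊨ limPoint b)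
  ¬limPoint {b} c<b h with ≅-sentence (limPoint b) (≅-sym S≅T) h
  ... | (i , v) , l with ≡𝟘⊎𝟘< v
  ... | inj₂ p = <-asym (c<b i) (lim⇒< lT (conv-Σω i) p l)
  ¬limPoint {b} c<b h | (zero , v) , l | inj₁ refl with lim-≤ lT {k = b} z≤n l
  ... | _ , idx ()
  ... | _ , inn {x = u} q = 𝟘-min u q
  ¬limPoint {b} c<b h | (suc i , v) , l | inj₁ refl =
    <-irrefl refl (<-≤-trans (c<b i) (lim-sup⇒≤ lT (conv-Σω i) (sup-next i) l))

-- Whatever follows ω^b leaves a trace: a least point becomes a b-limit, a descending term brings
-- unbased points.
limPoint⊎unbasedPoint : ∀ {l b} d → Good l → l 0 ≡ asc b → l 1 ≡ d → S l ⊨ limPoint b ⊎ S l ⊨ unbasedPoint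
limPoint⊎unbasedPoint {l} {b} (asc d) g e e′ =
  inj₁ (≅-sentence (limPoint b) (split l e) (_ , OrdinalHead.lim-next (S-lin (tl l)) b (asc-hasMin (tl l) e′)))
limPoint⊎unbasedPoint {l} (desc d) g e e′ with head-gap l e e′
... | inj₂ gap = inj₂ (≅-sentence unbasedPoint (split l e)
  (let _ , _ , nb = Descending.unbased-below (ωPow-lin _) (S-lin (tl l)) gap (desc-descending (tl l) e′) (point (tl l)) in _ , nb))
... | inj₁ (refl , refl) = inj₂ (≅-sentence unbasedPoint (glued-split g e e′)
  (let _ , _ , nb = Glued.unbased-below g e e′ (point (tl (tl l))) in _ , nb))

-- Since ω^a + ω^b = ω^b, the smaller head ω^a can be cancelled from S k without changing S l.
smaller-head : ∀ {k l a b} → Good k → k 0 ≡ asc a → l 0 ≡ asc b → a < b → S k ≡ₑ S l →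
  Σ ℕ λ c → k 1 ≡ asc c × c ≤ a × S (tl k) ≡ₑ S l
smaller-head {k} {l} {a} {b} g ek el a<b q = next (k 1) refl
  where
  absorb : S l ≅ ωPow a ⊕ S l
  absorb = ≅-trans (split l el) (≅-trans (⊕-cong (≅-sym (ωPow-absorb a<b)) ≅-refl)
    (≅-trans (⊕-assoc _ _ _) (⊕-cong ≅-refl (≅-sym (split l el)))))
  next : ∀ x → k 1 ≡ x → Σ ℕ λ c → k 1 ≡ asc c × c ≤ a × S (tl k) ≡ₑ S l
  next (desc c) e = ⊥-elim (¬limInBased g ek e (≡ₑ-sentence (limInBased a) (≡ₑ-sym q)
    (≅-sentence (limInBased a) absorb (limInBased-head (S-lin l) a (asc-hasMin l el)))))
  next (asc c) e = c , e , subst₂ Step ek e (Good.step g 0) ,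
    ≡ₑ-restrict (afterLim a)
      (OrdinalHead.defines-afterLim (S-lin (tl k)) a (asc-hasMin (tl k) e))
      (OrdinalHead.defines-afterLim (S-lin l) a (asc-hasMin l el))
      (≡ₑ-resp-≅ (split k ek) absorb q)

-- After each cancellation the new head is again a power below ω^b and the right-hand sum is
-- unchanged, so the step repeats `i` times.
all-smaller : ∀ {l b} i {k a} → Good k → k 0 ≡ asc a → l 0 ≡ asc b → a < b → S k ≡ₑ S l →
  Σ ℕ λ c → k i ≡ asc c × c < b
all-smaller zero    g ek el a<b q = _ , ek , a<b
all-smaller (suc i) g ek el a<b q =
  let c , e , c≤a , q′ = smaller-head g ek el a<b q
  in all-smaller i (tl-good g) e el (≤-<-trans c≤a a<b) q′

¬smaller-head : ∀ {k l a b} → Good k → Good l → k 0 ≡ asc a → l 0 ≡ asc b → a < b → ¬ (S k ≡ₑ S l)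
¬smaller-head {k} {l} {a} {b} g h ek el a<b q = refute (limPoint⊎unbasedPoint (l 1) h el refl)
  where
  terms : ∀ i → Σ ℕ λ c → k i ≡ asc c × c < b
  terms i = all-smaller i g ek el a<b q
  module A = AllAsc k (proj₁ ∘ terms) (proj₁ ∘ proj₂ ∘ terms)
    (λ i → subst₂ Step (proj₁ (proj₂ (terms i))) (proj₁ (proj₂ (terms (suc i)))) (Good.step g i))
  refute : S l ⊨ limPoint b ⊎ S l ⊨ unbasedPoint → ⊥
  refute (inj₁ m) = A.¬limPoint (proj₂ ∘ proj₂ ∘ terms) (≡ₑ-sentence (limPoint b) (≡ₑ-sym q) m)
  refute (inj₂ m) = A.¬unbasedPoint (≡ₑ-sentence unbasedPoint (≡ₑ-sym q) m)

-- Heads (ω*)^a, studied in the reversed sums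

ω*⊕-noMin : ∀ {R} x → Σ (Carrier (ω*Pow 1 ⊕ R)) λ y → y ≺[ ω*Pow 1 ⊕ R ] x
ω*⊕-noMin (inj₁ (n ∷ [])) = inj₁ (suc n ∷ []) , l<l (inj₁ ≤-refl)
ω*⊕-noMin (inj₂ r)        = inj₁ 𝟘 , l<r

-- One copy of ω is split off from ω^c, so that the reversed sum ends in ω* + ω^(a+1) with a visible
-- cut before it.
ζ-rest : ∀ {k a c} → Good k → k 0 ≡ desc a → k 1 ≡ asc c →
  Σ Terms λ r → S (tl k) ≅ ωPow 1 ⊕ S r × (∀ q → Gap (S r *) (ω*Pow 1 ⊕ ωPow q))
ζ-rest {k} {a} {c} g e e′ = rest c e′ (subst₂ Step e e′ (Good.step g 0))
  where
  gap-asc : ∀ r {d} → r 0 ≡ asc d → ∀ q → Gap (S r *) (ω*Pow 1 ⊕ ωPow q)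
  gap-asc r e q = gap-max (asc-hasMin r e) (ω*⊕-noMin {ωPow q})
  rest : ∀ c → k 1 ≡ asc c → 1 ≤ c →
    Σ Terms λ r → S (tl k) ≅ ωPow 1 ⊕ S r × (∀ q → Gap (S r *) (ω*Pow 1 ⊕ ωPow q))
  rest (suc zero) e′ _ = tl (tl k) , split (tl k) e′ , gap (k 2) refl
    where
    gap : ∀ x → k 2 ≡ x → ∀ q → Gap (S (tl (tl k)) *) (ω*Pow 1 ⊕ ωPow q)
    gap (asc d) e″        = gap-asc (tl (tl k)) e″
    -- In (ω*)^(a+1) + ω + ω* the cut after ω would be hidden; the special condition excludes this.
    gap (desc zero) e″    = ⊥-elim (Good.spec₂ g 0 a e e′ e″)
    gap (desc (suc d)) e″ = λ q → gap-limits (desc-unsucceededBelow (tl (tl k)) e″)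
  -- For exponents at least 2, ω + ω^c = ω^c, so the tail itself remains after ω is split off.
  rest (suc (suc c)) e′ _ = tl k , absorb , gap-asc (tl k) e′
    where
    absorb : S (tl k) ≅ ωPow 1 ⊕ S (tl k)
    absorb = ≅-trans (split (tl k) e′) (≅-trans (⊕-cong (≅-sym (ωPow-absorb (s≤s (s≤s z≤n)))) ≅-refl)
      (≅-trans (⊕-assoc _ _ _) (⊕-cong ≅-refl (≅-sym (split (tl k) e′)))))

ζ-split : ∀ k {a r} → k 0 ≡ desc a → S (tl k) ≅ ωPow 1 ⊕ S r → S k * ≅ S r * ⊕ (ω*Pow 1 ⊕ ωPow (suc a))
ζ-split k e i = ≅-trans (split* k e)
  (≅-trans (⊕-cong (≅-trans (≅-op i) (op-⊕ _ _)) ≅-refl) (⊕-assoc _ _ _))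

desc-step : ∀ {k a b} → Good k → k 0 ≡ desc a → k 1 ≡ desc b → S (tl k) * ⊨ cofinalLim a
desc-step {k} g e e′ = desc-cofinalLim (tl k) e′ (subst₂ Step e e′ (Good.step g 0))

limBeforeBased-desc : ∀ {k a b} → Good k → k 0 ≡ desc a → k 1 ≡ desc b → S k * ⊨ limBeforeBased (suc a)
limBeforeBased-desc {k} {a} g e e′ = ≅-sentence (limBeforeBased (suc a)) (split* k e)
  (OrdinalEnd.limBeforeBased-end (S*-lin (tl k)) (point (tl k)) (desc-step g e e′))

¬limBeforeBased : ∀ {k a c} → Good k → k 0 ≡ desc a → k 1 ≡ asc c → ¬ (S k * ⊨ limBeforeBased (suc a))
¬limBeforeBased {k} {a} g e e′ h with ζ-rest g e e′
... | r , i , gap = ζEnd.¬limBeforeBased-ζ (S*-lin r) a (gap (suc a))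
  (≅-sentence (limBeforeBased (suc a)) (≅-sym (ζ-split k e i)) h)

-- Cancelling a common head (ω*)^(a+1)

desc-cancel : ∀ {k l a} c d → Good k → Good l → k 0 ≡ desc a → l 0 ≡ desc a → k 1 ≡ c → l 1 ≡ d →
  S k ≡ₑ S l → S (tl k) ≡ₑ S (tl l)
desc-cancel {k} {l} {a} (desc c) (desc d) g h ek el ek′ el′ q =
  ≡ₑ-op (≡ₑ-restrict (beforeLim (suc a))
    (OrdinalEnd.defines-beforeLim (S*-lin (tl k)) (point (tl k)) (desc-step g ek ek′))
    (OrdinalEnd.defines-beforeLim (S*-lin (tl l)) (point (tl l)) (desc-step h el el′))
    (≡ₑ-resp-≅ (split* k ek) (split* l el) (≡ₑ-op q)))
desc-cancel {a = a} (asc c) (desc d) g h ek el ek′ el′ q = ⊥-elim (¬limBeforeBased g ek ek′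
  (≡ₑ-sentence (limBeforeBased (suc a)) (≡ₑ-op (≡ₑ-sym q)) (limBeforeBased-desc h el el′)))
desc-cancel {a = a} (desc c) (asc d) g h ek el ek′ el′ q = ⊥-elim (¬limBeforeBased h el el′
  (≡ₑ-sentence (limBeforeBased (suc a)) (≡ₑ-op q) (limBeforeBased-desc g ek ek′)))
desc-cancel {k} {l} {a} (asc c) (asc d) g h ek el ek′ el′ q with ζ-rest g ek ek′ | ζ-rest h el el′
-- The reversed sums are cut before ω* + ω^(a+1); reversing back, ω is restored in front of what
-- remains.
... | r , i , gr | s , j , gs = ≡ₑ-resp-≅ (≅-sym i) (≅-sym j) (⊕-congʳ-≡ₑ (ωPow 1) (point r)
  (≡ₑ-op (≡ₑ-restrict farBeforeUnbased
    (ζEnd.defines-farBeforeUnbased (S*-lin r) a (gr (suc a)))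
    (ζEnd.defines-farBeforeUnbased (S*-lin s) a (gs (suc a)))
    (≡ₑ-resp-≅ (ζ-split k ek i) (ζ-split l el j) (≡ₑ-op q)))))

-- In the reversed sums, (a+1)-limits are cofinal in the final ω^(b+1) but not in the final ω^(a+1).
¬smaller-desc : ∀ {k l a b} → k 0 ≡ desc a → l 0 ≡ desc b → a < b → ¬ (S k ≡ₑ S l)
¬smaller-desc {k} {l} {a} ek el a<b q = OrdinalEnd.¬cofinalLim-end (S*-lin (tl k)) ≤-refl
  (≅-sentence (cofinalLim (suc a)) (≅-sym (split* k ek))
    (≡ₑ-sentence (cofinalLim (suc a)) (≡ₑ-op (≡ₑ-sym q)) (desc-cofinalLim l el a<b)))

-- Recovering the terms one at a time

cancel : ∀ {k l} x y → Good k → Good l → k 0 ≡ x → l 0 ≡ y → S k ≡ₑ S l →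
  x ≡ y × S (tl k) ≡ₑ S (tl l)
-- The direction of the head is visible: only an ascending head has a least point.
cancel {k} {l} (asc a) (desc b) g h ek el q = ⊥-elim (¬desc-hasMin l el (≡ₑ-sentence hasMin q (asc-hasMin k ek)))
cancel {k} {l} (desc a) (asc b) g h ek el q = ⊥-elim (¬desc-hasMin k ek (≡ₑ-sentence hasMin (≡ₑ-sym q) (asc-hasMin l el)))
cancel (asc a) (asc b) g h ek el q with <-cmp a b
... | tri< a<b _ _  = ⊥-elim (¬smaller-head g h ek el a<b q)
... | tri> _ _ b<a  = ⊥-elim (¬smaller-head h g el ek b<a (≡ₑ-sym q))
... | tri≈ _ refl _ = refl , asc-cancel _ _ g h ek el refl refl q
cancel (desc a) (desc b) g h ek el q with <-cmp a b
... | tri< a<b _ _  = ⊥-elim (¬smaller-desc ek el a<b q)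
... | tri> _ _ b<a  = ⊥-elim (¬smaller-desc el ek b<a (≡ₑ-sym q))
... | tri≈ _ refl _ = refl , desc-cancel _ _ g h ek el refl refl q

terms-unique : ∀ {k l} → Good k → Good l → S k ≡ₑ S l → ∀ i → k i ≡ l i
terms-unique {k} {l} g h q zero    = proj₁ (cancel (k 0) (l 0) g h refl refl q)
terms-unique {k} {l} g h q (suc i) =
  terms-unique (tl-good g) (tl-good h) (proj₂ (cancel (k 0) (l 0) g h refl refl q)) i

S-cong : ∀ {k l} → (∀ i → k i ≡ l i) → S k ≅ S l
S-cong {k} {l} e = ≅-trans (S≅Σω λ i → subst (λ x → ⟪ k i ⟫ ≅ ⟪ x ⟫) (e i) ≅-refl)
  (≅-sym (S≅Σω {l} λ i → ≅-refl))

-- Normalising codes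

norm : Code → Term
norm (fwd , a)     = asc a
norm (bwd , zero)  = asc 0
norm (bwd , suc a) = desc a

⟦⟧≅⟪norm⟫ : ∀ c → ⟦ c ⟧ ≅ ⟪ norm c ⟫
⟦⟧≅⟪norm⟫ (fwd , a)     = ≅-refl
⟦⟧≅⟪norm⟫ (bwd , suc a) = ≅-refl
⟦⟧≅⟪norm⟫ (bwd , zero)  = record
  { to = id ; from = id ; from∘to = λ _ → refl ; to∘from = λ _ → refl
  ; mono = λ { [] [] → mk⇔ id id } }

step? : ∀ x y → Step x y ⊎ ((⟪ x ⟫ ⊕ ⟪ y ⟫ ≅ ⟪ x ⟫) ⊎ (⟪ x ⟫ ⊕ ⟪ y ⟫ ≅ ⟪ y ⟫))
step? (asc a) (asc b) with b ≤? a
... | yes b≤a = inj₁ b≤a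
... | no b≰a  = inj₂ (inj₂ (ωPow-absorb (≰⇒> b≰a)))
step? (asc a) (desc b) = inj₁ tt
step? (desc a) (asc (suc b)) = inj₁ (s≤s z≤n)
-- The single point is read as (ω*)^0, which (ω*)^(a+1) absorbs.
step? (desc a) (asc zero) = inj₂ (inj₁ (≅-trans (⊕-cong ≅-refl (≅-sym (⟦⟧≅⟪norm⟫ (bwd , 0)))) (ω*Pow-absorb (s≤s z≤n))))
step? (desc a) (desc b) with a ≤? b
... | yes a≤b = inj₁ a≤b
... | no a≰b  = inj₂ (inj₁ (ω*Pow-absorb (s≤s (≰⇒> a≰b))))

norm-asc : ∀ c {a} → norm c ≡ asc (suc a) → c ≡ (fwd , suc a)
norm-asc (fwd , _)     refl = refl
norm-asc (bwd , zero)  ()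
norm-asc (bwd , suc _) ()

norm-desc : ∀ c {a} → norm c ≡ desc a → c ≡ (bwd , suc a)
norm-desc (bwd , suc _) refl = refl
norm-desc (bwd , zero)  ()
norm-desc (fwd , _)     ()

good : ∀ {t} → SpecialMonomial t → Good (norm ∘ t)
good {t} (mono , special) = record
  { step = λ i → step i (step? (norm (t i)) (norm (t (suc i))))
  ; spec₁ = λ { i e e′ (suc m) _ e″ → proj₁ (special i)
      (norm-asc (t i) e , norm-desc (t (suc i)) e′ , suc m , s≤s z≤n , norm-asc (t (suc (suc i))) e″) }
  ; spec₂ = λ i m e e′ e″ → proj₂ (special i)
      ((suc m , s≤s z≤n , norm-desc (t i) e) , norm-asc (t (suc i)) e′ , norm-desc (t (suc (suc i))) e″) }
  where
  pair : ∀ i → ⟦ t i ⟧ ⊕ ⟦ t (suc i) ⟧ ≅ ⟪ norm (t i) ⟫ ⊕ ⟪ norm (t (suc i)) ⟫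
  pair i = ⊕-cong (⟦⟧≅⟪norm⟫ (t i)) (⟦⟧≅⟪norm⟫ (t (suc i)))
  step : ∀ i → Step (norm (t i)) (norm (t (suc i))) ⊎ _ → Step (norm (t i)) (norm (t (suc i)))
  step i (inj₁ s)        = s
  step i (inj₂ (inj₁ j)) = ⊥-elim (proj₁ (mono i) (≅-trans (pair i) (≅-trans j (≅-sym (⟦⟧≅⟪norm⟫ (t i))))))
  step i (inj₂ (inj₂ j)) = ⊥-elim (proj₂ (mono i) (≅-trans (pair i) (≅-trans j (≅-sym (⟦⟧≅⟪norm⟫ (t (suc i)))))))

SumOf≅S : ∀ t → SumOf t ≅ S (norm ∘ t)
SumOf≅S t = ≅-sym (S≅Σω λ i → ≅-sym (⟦⟧≅⟪norm⟫ (t i)))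

theorem4p5 : (t u : ℕ → Code) → SpecialMonomial t → SpecialMonomial u →
    (SumOf t ≅ SumOf u) ⇔ (SumOf t ≡ₑ SumOf u)
theorem4p5 t u st su = mk⇔ ≅⇒≡ₑ λ q →
  ≅-trans (SumOf≅S t) (≅-trans (S-cong (terms-unique (good st) (good su) (≡ₑ-resp-≅ (SumOf≅S t) (SumOf≅S u) q)))
    (≅-sym (SumOf≅S u)))
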